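{- Let $G$ be a finite simple graph on $n\ge1$ vertices. Then there is exactly one pair of nonnegative integers $(k,m)$ with $2k+m=n$ such that $G(k,m)$ lies in the same Clifford class as $G$, i.e. $\dim_{\mathbb{C}} Z(A_{G(k,m)})=\dim_{\mathbb{C}} Z(A_G)$.
   Context: All graphs are finite, with no loops and no multiple edges. For a graph $G$ with vertices numbered $1,\dots,n$, the Clifford graph algebra $A_G$ is the unital associative $\mathbb{C}$-algebra generated by $e_1,\dots,e_n$ subject to the relations $e_i^2=-1$ for all $i$; $e_ie_j=-e_je_i$ if $i\neq j$ and vertices $i,j$ are adjacent; and $e_ie_j=e_je_i$ if $i\ne j$ and vertices $i,j$ are not adjacent. $Z(A)$ denotes the center. Two graphs with the same number of vertices are in the same Clifford class if the centers of their Clifford graph algebras have the same dimension. For nonnegative integers $k,m$, $G(k,m)$ denotes the graph on $2k+m$ vertices that is the disjoint union of $k$ copies of $K_2$ (a single edge) and $m$ isolated vertices. -}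

module Defs where

open import Algebra.Bundles using (CommutativeRing; Ring)
open import Algebra.Module.Bundles using (LeftModule)
open import Algebra.Module.Structures using (IsLeftModule)
open import Algebra.Structures using (IsCommutativeRing)
import Algebra.Properties.CommutativeMonoid.Sum as Sum
import Algebra.Properties.Ring as RingProperties
open import Data.Empty using (⊥)
open import Data.Fin.Base using (Fin; splitAt)
import Data.Fin.Properties as Fin
open import Data.Nat.Base as ℕ using (ℕ; zero; suc; _⊔_)
import Data.Nat.Properties as ℕ
open import Data.Product.Base using (Σ; ∃; _×_; _,_; proj₁)
open import Data.Rational.Base as ℚ using (ℚ; 0ℚ; 1ℚ; ½; ∣_∣)
import Data.Rational.Properties as ℚ
open import Data.Sum.Relation.Binary.Pointwise
  using (Pointwise; inj₁; inj₂; ⊎-symmetric; ⊎-decidable)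
open import Data.Vec.Functional using (Vector)
open import Level using (Level; 0ℓ) renaming (_⊔_ to _⊔ˡ_; suc to lsuc)
open import Relation.Binary.Core using (Rel)
open import Relation.Binary.Definitions using (Decidable; Irreflexive; Symmetric)
open import Relation.Binary.PropositionalEquality
  using (_≡_; _≢_; refl; sym; trans; cong; subst; subst₂; ≢-sym; module ≡-Reasoning)
open import Relation.Binary.Structures using (IsEquivalence)
open import Relation.Nullary.Decidable.Core using (no; ¬?; dec⇒maybe)
open import Relation.Nullary.Negation.Core using (¬_)
open import Tactic.RingSolver using (solve-∀)
open import Tactic.RingSolver.Core.AlmostCommutativeRing
  using (AlmostCommutativeRing; fromCommutativeRing)

-- The real numbers: Cauchy sequences of rationals, with two sequences
-- identified when their difference tends to 0.

IsCauchy : (ℕ → ℚ) → Set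
IsCauchy s = ∀ ε → 0ℚ ℚ.< ε →
  ∃ λ N → ∀ m n → N ℕ.≤ m → N ℕ.≤ n → ∣ s m ℚ.- s n ∣ ℚ.< ε

IsNull : (ℕ → ℚ) → Set
IsNull s = ∀ ε → 0ℚ ℚ.< ε → ∃ λ N → ∀ n → N ℕ.≤ n → ∣ s n ∣ ℚ.< ε

-- Eta is switched off and the operations are given by copatterns so that
-- they do not unfold during unification.
record ℝ : Set where
  no-eta-equality
  field
    seq    : ℕ → ℚ
    cauchy : IsCauchy seq

open ℝ public

diff : ℝ → ℝ → ℕ → ℚ
diff x y n = seq x n ℚ.- seq y n

infix 4 _≈ℝ_

record _≈ℝ_ (x y : ℝ) : Set where
  constructor mk≈ℝ
  field
    null : IsNull (diff x y)

open _≈ℝ_ public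

module CauchyLemmas where

  ℚ-acr : AlmostCommutativeRing 0ℓ 0ℓ
  ℚ-acr = fromCommutativeRing ℚ.+-*-commutativeRing (λ q → dec⇒maybe (0ℚ ℚ.≟ q))

  half-pos : ∀ {ε} → 0ℚ ℚ.< ε → 0ℚ ℚ.< ½ ℚ.* ε
  half-pos {ε} ε>0 =
    subst (ℚ._< ½ ℚ.* ε) (ℚ.*-zeroʳ ½) (ℚ.*-monoʳ-<-pos ½ ε>0)

  halves : ∀ ε → ½ ℚ.* ε ℚ.+ ½ ℚ.* ε ≡ ε
  halves ε = trans (sym (ℚ.*-distribʳ-+ ε ½ ½)) (ℚ.*-identityˡ ε)

  ∣∣-sum-< : ∀ {a b ε} → ∣ a ∣ ℚ.< ½ ℚ.* ε → ∣ b ∣ ℚ.< ½ ℚ.* ε → ∣ a ℚ.+ b ∣ ℚ.< ε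
  ∣∣-sum-< {a} {b} {ε} a< b< =
    ℚ.≤-<-trans (ℚ.∣p+q∣≤∣p∣+∣q∣ a b)
      (subst (∣ a ∣ ℚ.+ ∣ b ∣ ℚ.<_) (halves ε) (ℚ.+-mono-< a< b<))

  quot : ∀ A → 0ℚ ℚ.< A → ℚ → ℚ
  quot A A>0 ε = (ℚ.1/ A) ℚ.* ε
    where instance _ = ℚ.pos⇒nonZero A {{ℚ.positive A>0}}

  quot-pos : ∀ A (A>0 : 0ℚ ℚ.< A) {ε} → 0ℚ ℚ.< ε → 0ℚ ℚ.< quot A A>0 ε
  quot-pos A A>0 {ε} ε>0 =
    subst (ℚ._< quot A A>0 ε) (ℚ.*-zeroʳ (ℚ.1/ A)) (ℚ.*-monoʳ-<-pos (ℚ.1/ A) ε>0)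
    where instance
      A-pos = ℚ.positive A>0
      A-nonZero = ℚ.pos⇒nonZero A
      1/A-pos = ℚ.1/pos⇒pos A

  *-quot : ∀ A (A>0 : 0ℚ ℚ.< A) ε → A ℚ.* quot A A>0 ε ≡ ε
  *-quot A A>0 ε = begin
    A ℚ.* (ℚ.1/ A ℚ.* ε)   ≡⟨ sym (ℚ.*-assoc A (ℚ.1/ A) ε) ⟩
    (A ℚ.* ℚ.1/ A) ℚ.* ε   ≡⟨ cong (ℚ._* ε) (ℚ.*-inverseʳ A) ⟩
    1ℚ ℚ.* ε               ≡⟨ ℚ.*-identityˡ ε ⟩
    ε                      ∎
    where
    open ≡-Reasoning
    instance _ = ℚ.pos⇒nonZero A {{ℚ.positive A>0}}

  ∣∣-product-< : ∀ {a b} A (A>0 : 0ℚ ℚ.< A) {ε} →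
                 ∣ a ∣ ℚ.< A → ∣ b ∣ ℚ.< quot A A>0 ε → ∣ a ℚ.* b ∣ ℚ.< ε
  ∣∣-product-< {a} {b} A A>0 {ε} a< b< =
    subst₂ ℚ._<_ (sym (ℚ.∣p*q∣≡∣p∣*∣q∣ a b)) (*-quot A A>0 ε)
      (ℚ.≤-<-trans
        (ℚ.*-monoʳ-≤-nonNeg ∣ b ∣ {{ℚ.∣-∣-nonNeg b}} (ℚ.<⇒≤ a<))
        (ℚ.*-monoʳ-<-pos A {{ℚ.positive A>0}} b<))

  eventuallyBounded : ∀ {s} → IsCauchy s →
    ∃ λ A → 0ℚ ℚ.< A × ∃ λ N → ∀ n → N ℕ.≤ n → ∣ s n ∣ ℚ.< A
  eventuallyBounded {s} c with c 1ℚ (ℚ.positive⁻¹ 1ℚ)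
  ... | N , bound = 1ℚ ℚ.+ ∣ s N ∣ , A>0 , N , below
    where
    A>0 : 0ℚ ℚ.< 1ℚ ℚ.+ ∣ s N ∣
    A>0 = ℚ.+-mono-<-≤ (ℚ.positive⁻¹ 1ℚ) (ℚ.0≤∣p∣ (s N))

    below : ∀ n → N ℕ.≤ n → ∣ s n ∣ ℚ.< 1ℚ ℚ.+ ∣ s N ∣
    below n N≤n = ℚ.≤-<-trans
      (subst (λ t → ∣ t ∣ ℚ.≤ ∣ s n ℚ.- s N ∣ ℚ.+ ∣ s N ∣) (cancel (s n) (s N))
        (ℚ.∣p+q∣≤∣p∣+∣q∣ (s n ℚ.- s N) (s N)))
      (ℚ.+-monoˡ-< ∣ s N ∣ (bound n N N≤n ℕ.≤-refl))
      where
      cancel : ∀ p q → (p ℚ.- q) ℚ.+ q ≡ p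
      cancel p q = trans (ℚ.+-assoc p (ℚ.- q) q)
        (trans (cong (p ℚ.+_) (ℚ.+-inverseˡ q)) (ℚ.+-identityʳ p))

  null-resp : ∀ {s t} → (∀ n → s n ≡ t n) → IsNull s → IsNull t
  null-resp s≡t s-null ε ε>0 with s-null ε ε>0
  ... | N , bound = N , λ n N≤n → subst (λ p → ∣ p ∣ ℚ.< ε) (s≡t n) (bound n N≤n)

  null-0 : IsNull (λ _ → 0ℚ)
  null-0 ε ε>0 = 0 , λ _ _ → ε>0

  null-neg : ∀ {s} → IsNull s → IsNull (λ n → ℚ.- s n)
  null-neg {s} s-null ε ε>0 with s-null ε ε>0
  ... | N , bound = N , λ n N≤n → subst (ℚ._< ε) (sym (ℚ.∣-p∣≡∣p∣ (s n))) (bound n N≤n)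

  null-+ : ∀ {s t} → IsNull s → IsNull t → IsNull (λ n → s n ℚ.+ t n)
  null-+ {s} {t} s-null t-null ε ε>0
    with s-null (½ ℚ.* ε) (half-pos ε>0) | t-null (½ ℚ.* ε) (half-pos ε>0)
  ... | M , s< | N , t< = M ⊔ N , λ n le →
    ∣∣-sum-< {s n} {t n} (s< n (ℕ.m⊔n≤o⇒m≤o M N le)) (t< n (ℕ.m⊔n≤o⇒n≤o M N le))

  null-* : ∀ {s t} → IsCauchy s → IsNull t → IsNull (λ n → s n ℚ.* t n)
  null-* {s} {t} s-cauchy t-null ε ε>0 with eventuallyBounded s-cauchy
  ... | A , A>0 , M , s< with t-null (quot A A>0 ε) (quot-pos A A>0 ε>0)
  ... | N , t< = M ⊔ N , λ n le →
    ∣∣-product-< {s n} {t n} A A>0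
      (s< n (ℕ.m⊔n≤o⇒m≤o M N le)) (t< n (ℕ.m⊔n≤o⇒n≤o M N le))

  cauchy-const : ∀ q → IsCauchy (λ _ → q)
  cauchy-const q ε ε>0 = 0 , λ _ _ _ _ →
    subst (λ p → ∣ p ∣ ℚ.< ε) (sym (ℚ.+-inverseʳ q)) ε>0

  cauchy-neg : ∀ {s} → IsCauchy s → IsCauchy (λ n → ℚ.- s n)
  cauchy-neg {s} s-cauchy ε ε>0 with s-cauchy ε ε>0
  ... | N , bound = N , λ m n N≤m N≤n →
    subst (ℚ._< ε)
      (trans (sym (ℚ.∣-p∣≡∣p∣ (s m ℚ.- s n)))
             (cong ∣_∣ (ℚ.neg-distrib-+ (s m) (ℚ.- s n))))
      (bound m n N≤m N≤n)

  cauchy-+ : ∀ {s t} → IsCauchy s → IsCauchy t → IsCauchy (λ n → s n ℚ.+ t n)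
  cauchy-+ {s} {t} s-cauchy t-cauchy ε ε>0
    with s-cauchy (½ ℚ.* ε) (half-pos ε>0) | t-cauchy (½ ℚ.* ε) (half-pos ε>0)
  ... | M , s< | N , t< = M ⊔ N , λ m n le le′ →
    subst (λ p → ∣ p ∣ ℚ.< ε) (rearrange (s m) (s n) (t m) (t n))
      (∣∣-sum-< {s m ℚ.- s n} {t m ℚ.- t n}
        (s< m n (ℕ.m⊔n≤o⇒m≤o M N le) (ℕ.m⊔n≤o⇒m≤o M N le′))
        (t< m n (ℕ.m⊔n≤o⇒n≤o M N le) (ℕ.m⊔n≤o⇒n≤o M N le′)))
    where
    rearrange : ∀ a b c d → (a ℚ.+ ℚ.- b) ℚ.+ (c ℚ.+ ℚ.- d) ≡ (a ℚ.+ c) ℚ.+ ℚ.- (b ℚ.+ d)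
    rearrange = solve-∀ ℚ-acr

  cauchy-* : ∀ {s t} → IsCauchy s → IsCauchy t → IsCauchy (λ n → s n ℚ.* t n)
  cauchy-* {s} {t} s-cauchy t-cauchy ε ε>0
    with eventuallyBounded s-cauchy | eventuallyBounded t-cauchy
  ... | A , A>0 , M , s< | B , B>0 , N , t<
    with s-cauchy (quot B B>0 (½ ℚ.* ε)) (quot-pos B B>0 (half-pos ε>0))
       | t-cauchy (quot A A>0 (½ ℚ.* ε)) (quot-pos A A>0 (half-pos ε>0))
  ... | P , Δs< | Q , Δt< = (M ⊔ N) ⊔ (P ⊔ Q) , λ m n le le′ →
    let MN≤m = ℕ.m⊔n≤o⇒m≤o (M ⊔ N) (P ⊔ Q) le
        MN≤n = ℕ.m⊔n≤o⇒m≤o (M ⊔ N) (P ⊔ Q) le′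
        PQ≤m = ℕ.m⊔n≤o⇒n≤o (M ⊔ N) (P ⊔ Q) le
        PQ≤n = ℕ.m⊔n≤o⇒n≤o (M ⊔ N) (P ⊔ Q) le′
    in subst (λ p → ∣ p ∣ ℚ.< ε) (rearrange (s m) (s n) (t m) (t n))
      (∣∣-sum-< {s m ℚ.* (t m ℚ.- t n)} {t n ℚ.* (s m ℚ.- s n)}
        (∣∣-product-< {s m} {t m ℚ.- t n} A A>0 (s< m (ℕ.m⊔n≤o⇒m≤o M N MN≤m))
          (Δt< m n (ℕ.m⊔n≤o⇒n≤o P Q PQ≤m) (ℕ.m⊔n≤o⇒n≤o P Q PQ≤n)))
        (∣∣-product-< {t n} {s m ℚ.- s n} B B>0 (t< n (ℕ.m⊔n≤o⇒n≤o M N MN≤n))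
          (Δs< m n (ℕ.m⊔n≤o⇒m≤o P Q PQ≤m) (ℕ.m⊔n≤o⇒m≤o P Q PQ≤n))))
    where
    rearrange : ∀ a b c d →
      a ℚ.* (c ℚ.+ ℚ.- d) ℚ.+ d ℚ.* (a ℚ.+ ℚ.- b) ≡ a ℚ.* c ℚ.+ ℚ.- (b ℚ.* d)
    rearrange = solve-∀ ℚ-acr

open CauchyLemmas

infixl 6 _+ℝ_
infixl 7 _*ℝ_
infix  8 -ℝ_

0ℝ 1ℝ : ℝ
0ℝ .seq _  = 0ℚ
0ℝ .cauchy = cauchy-const 0ℚ
1ℝ .seq _  = 1ℚ
1ℝ .cauchy = cauchy-const 1ℚ

_+ℝ_ _*ℝ_ : ℝ → ℝ → ℝ
(x +ℝ y) .seq n  = seq x n ℚ.+ seq y n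
(x +ℝ y) .cauchy = cauchy-+ {seq x} {seq y} (cauchy x) (cauchy y)
(x *ℝ y) .seq n  = seq x n ℚ.* seq y n
(x *ℝ y) .cauchy = cauchy-* {seq x} {seq y} (cauchy x) (cauchy y)

-ℝ_ : ℝ → ℝ
(-ℝ x) .seq n  = ℚ.- seq x n
(-ℝ x) .cauchy = cauchy-neg {seq x} (cauchy x)

≈ℝ-pointwise : ∀ {x y} → (∀ n → seq x n ≡ seq y n) → x ≈ℝ y
≈ℝ-pointwise {x} {y} x≡y = mk≈ℝ (null-resp
  (λ n → trans (sym (ℚ.+-inverseʳ (seq y n)))
               (cong (ℚ._- seq y n) (sym (x≡y n))))
  null-0)

≈ℝ-isEquivalence : IsEquivalence _≈ℝ_
≈ℝ-isEquivalence = record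
  { refl  = ≈ℝ-pointwise (λ _ → refl)
  ; sym   = λ {x} {y} p → mk≈ℝ
      (null-resp (λ n → swap (seq x n) (seq y n)) (null-neg {diff x y} (null p)))
  ; trans = λ {x} {y} {z} p q → mk≈ℝ
      (null-resp (λ n → telescope (seq x n) (seq y n) (seq z n))
        (null-+ {diff x y} {diff y z} (null p) (null q)))
  }
  where
  swap : ∀ a b → ℚ.- (a ℚ.+ ℚ.- b) ≡ b ℚ.+ ℚ.- a
  swap = solve-∀ ℚ-acr

  telescope : ∀ a b c → (a ℚ.+ ℚ.- b) ℚ.+ (b ℚ.+ ℚ.- c) ≡ a ℚ.+ ℚ.- c
  telescope = solve-∀ ℚ-acr

ℝ-isCommutativeRing : IsCommutativeRing _≈ℝ_ _+ℝ_ _*ℝ_ -ℝ_ 0ℝ 1ℝ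
ℝ-isCommutativeRing = record
  { isRing = record
    { +-isAbelianGroup = record
      { isGroup = record
        { isMonoid = record
          { isSemigroup = record
            { isMagma = record
              { isEquivalence = ≈ℝ-isEquivalence
              ; ∙-cong = λ {x} {y} {u} {v} p q → mk≈ℝ (null-resp
                  (λ n → +-diff (seq x n) (seq y n) (seq u n) (seq v n))
                  (null-+ {diff x y} {diff u v} (null p) (null q)))
              }
            ; assoc = λ x y z → ≈ℝ-pointwise λ n → ℚ.+-assoc (seq x n) (seq y n) (seq z n)
            }
          ; identity = (λ x → ≈ℝ-pointwise λ n → ℚ.+-identityˡ (seq x n))
                     , (λ x → ≈ℝ-pointwise λ n → ℚ.+-identityʳ (seq x n))
          }
        ; inverse = (λ x → ≈ℝ-pointwise λ n → ℚ.+-inverseˡ (seq x n))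
                  , (λ x → ≈ℝ-pointwise λ n → ℚ.+-inverseʳ (seq x n))
        ; ⁻¹-cong = λ {x} {y} p → mk≈ℝ (null-resp
            (λ n → ℚ.neg-distrib-+ (seq x n) (ℚ.- seq y n)) (null-neg {diff x y} (null p)))
        }
      ; comm = λ x y → ≈ℝ-pointwise λ n → ℚ.+-comm (seq x n) (seq y n)
      }
    ; *-cong = λ {x} {y} {u} {v} p q → mk≈ℝ (null-resp
        (λ n → *-diff (seq x n) (seq y n) (seq u n) (seq v n))
        (null-+ {λ n → seq x n ℚ.* diff u v n} {λ n → seq v n ℚ.* diff x y n}
          (null-* {seq x} {diff u v} (cauchy x) (null q))
          (null-* {seq v} {diff x y} (cauchy v) (null p))))
    ; *-assoc = λ x y z → ≈ℝ-pointwise λ n → ℚ.*-assoc (seq x n) (seq y n) (seq z n)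
    ; *-identity = (λ x → ≈ℝ-pointwise λ n → ℚ.*-identityˡ (seq x n))
                 , (λ x → ≈ℝ-pointwise λ n → ℚ.*-identityʳ (seq x n))
    ; distrib = (λ x y z → ≈ℝ-pointwise λ n → ℚ.*-distribˡ-+ (seq x n) (seq y n) (seq z n))
              , (λ x y z → ≈ℝ-pointwise λ n → ℚ.*-distribʳ-+ (seq x n) (seq y n) (seq z n))
    }
  ; *-comm = λ x y → ≈ℝ-pointwise λ n → ℚ.*-comm (seq x n) (seq y n)
  }
  where
  +-diff : ∀ a b c d → (a ℚ.+ ℚ.- b) ℚ.+ (c ℚ.+ ℚ.- d) ≡ (a ℚ.+ c) ℚ.+ ℚ.- (b ℚ.+ d)
  +-diff = solve-∀ ℚ-acr

  *-diff : ∀ a b c d →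
    a ℚ.* (c ℚ.+ ℚ.- d) ℚ.+ d ℚ.* (a ℚ.+ ℚ.- b) ≡ a ℚ.* c ℚ.+ ℚ.- (b ℚ.* d)
  *-diff = solve-∀ ℚ-acr

ℝ-commutativeRing : CommutativeRing 0ℓ 0ℓ
ℝ-commutativeRing = record { isCommutativeRing = ℝ-isCommutativeRing }

record ℂ : Set where
  no-eta-equality
  field
    re im : ℝ

open ℂ public

infix  4 _≈ℂ_
infixl 6 _+ℂ_
infixl 7 _*ℂ_
infix  8 -ℂ_

record _≈ℂ_ (z w : ℂ) : Set where
  constructor mk≈ℂ
  field
    re≈ : re z ≈ℝ re w
    im≈ : im z ≈ℝ im w

open _≈ℂ_ public

0ℂ 1ℂ : ℂ
0ℂ .re = 0ℝ
0ℂ .im = 0ℝ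
1ℂ .re = 1ℝ
1ℂ .im = 0ℝ

_+ℂ_ _*ℂ_ : ℂ → ℂ → ℂ
(z +ℂ w) .re = re z +ℝ re w
(z +ℂ w) .im = im z +ℝ im w
(z *ℂ w) .re = re z *ℝ re w +ℝ -ℝ (im z *ℝ im w)
(z *ℂ w) .im = re z *ℝ im w +ℝ im z *ℝ re w

-ℂ_ : ℂ → ℂ
(-ℂ z) .re = -ℝ re z
(-ℂ z) .im = -ℝ im z

ℂ-isCommutativeRing : IsCommutativeRing _≈ℂ_ _+ℂ_ _*ℂ_ -ℂ_ 0ℂ 1ℂ
ℂ-isCommutativeRing = record
  { isRing = record
    { +-isAbelianGroup = record
      { isGroup = record
        { isMonoid = record
          { isSemigroup = record
            { isMagma = record
              { isEquivalence = record
                { refl  = mk≈ℂ R.refl R.refl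
                ; sym   = λ p → mk≈ℂ (R.sym (re≈ p)) (R.sym (im≈ p))
                ; trans = λ p q → mk≈ℂ (R.trans (re≈ p) (re≈ q)) (R.trans (im≈ p) (im≈ q))
                }
              ; ∙-cong = λ p q → mk≈ℂ (R.+-cong (re≈ p) (re≈ q)) (R.+-cong (im≈ p) (im≈ q))
              }
            ; assoc = λ x y z → mk≈ℂ (R.+-assoc (re x) (re y) (re z)) (R.+-assoc (im x) (im y) (im z))
            }
          ; identity = (λ x → mk≈ℂ (R.+-identityˡ (re x)) (R.+-identityˡ (im x)))
                     , (λ x → mk≈ℂ (R.+-identityʳ (re x)) (R.+-identityʳ (im x)))
          }
        ; inverse = (λ x → mk≈ℂ (R.-‿inverseˡ (re x)) (R.-‿inverseˡ (im x)))
                  , (λ x → mk≈ℂ (R.-‿inverseʳ (re x)) (R.-‿inverseʳ (im x)))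
        ; ⁻¹-cong = λ p → mk≈ℂ (R.-‿cong (re≈ p)) (R.-‿cong (im≈ p))
        }
      ; comm = λ x y → mk≈ℂ (R.+-comm (re x) (re y)) (R.+-comm (im x) (im y))
      }
    ; *-cong = λ p q → mk≈ℂ
        (R.+-cong (R.*-cong (re≈ p) (re≈ q)) (R.-‿cong (R.*-cong (im≈ p) (im≈ q))))
        (R.+-cong (R.*-cong (re≈ p) (im≈ q)) (R.*-cong (im≈ p) (re≈ q)))
    ; *-assoc = λ x y z → mk≈ℂ
        (≈ℝ-pointwise λ n → assoc-re (seq (re x) n) (seq (im x) n) (seq (re y) n) (seq (im y) n)
            (seq (re z) n) (seq (im z) n))
        (≈ℝ-pointwise λ n → assoc-im (seq (re x) n) (seq (im x) n) (seq (re y) n) (seq (im y) n)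
            (seq (re z) n) (seq (im z) n))
    ; *-identity =
        (λ x → mk≈ℂ (≈ℝ-pointwise λ n → idˡ-re (seq (re x) n) (seq (im x) n))
                  (≈ℝ-pointwise λ n → idˡ-im (seq (re x) n) (seq (im x) n)))
      , (λ x → mk≈ℂ (≈ℝ-pointwise λ n → idʳ-re (seq (re x) n) (seq (im x) n))
                  (≈ℝ-pointwise λ n → idʳ-im (seq (re x) n) (seq (im x) n)))
    ; distrib =
        (λ x y z → mk≈ℂ
          (≈ℝ-pointwise λ n → distribˡ-re (seq (re x) n) (seq (im x) n) (seq (re y) n) (seq (im y) n)
            (seq (re z) n) (seq (im z) n))
          (≈ℝ-pointwise λ n → distribˡ-im (seq (re x) n) (seq (im x) n) (seq (re y) n) (seq (im y) n)
            (seq (re z) n) (seq (im z) n)))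
      , (λ x y z → mk≈ℂ
          (≈ℝ-pointwise λ n → distribʳ-re (seq (re x) n) (seq (im x) n) (seq (re y) n) (seq (im y) n)
            (seq (re z) n) (seq (im z) n))
          (≈ℝ-pointwise λ n → distribʳ-im (seq (re x) n) (seq (im x) n) (seq (re y) n) (seq (im y) n)
            (seq (re z) n) (seq (im z) n)))
    }
  ; *-comm = λ x y → mk≈ℂ
      (≈ℝ-pointwise λ n → comm-re (seq (re x) n) (seq (im x) n) (seq (re y) n) (seq (im y) n))
      (≈ℝ-pointwise λ n → comm-im (seq (re x) n) (seq (im x) n) (seq (re y) n) (seq (im y) n))
  }
  where
  module R = CommutativeRing ℝ-commutativeRing
  open AlmostCommutativeRing ℚ-acr using (_+_; _*_; -_; 0#; 1#)

  assoc-re : ∀ a b c d e f →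
    (a * c + - (b * d)) * e + - ((a * d + b * c) * f) ≡
    a * (c * e + - (d * f)) + - (b * (c * f + d * e))
  assoc-re = solve-∀ ℚ-acr
  assoc-im : ∀ a b c d e f →
    (a * c + - (b * d)) * f + (a * d + b * c) * e ≡
    a * (c * f + d * e) + b * (c * e + - (d * f))
  assoc-im = solve-∀ ℚ-acr
  idˡ-re : ∀ a b → 1# * a + - (0# * b) ≡ a
  idˡ-re = solve-∀ ℚ-acr
  idˡ-im : ∀ a b → 1# * b + 0# * a ≡ b
  idˡ-im = solve-∀ ℚ-acr
  idʳ-re : ∀ a b → a * 1# + - (b * 0#) ≡ a
  idʳ-re = solve-∀ ℚ-acr
  idʳ-im : ∀ a b → a * 0# + b * 1# ≡ b
  idʳ-im = solve-∀ ℚ-acr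
  distribˡ-re : ∀ a b c d e f →
    a * (c + e) + - (b * (d + f)) ≡ (a * c + - (b * d)) + (a * e + - (b * f))
  distribˡ-re = solve-∀ ℚ-acr
  distribˡ-im : ∀ a b c d e f →
    a * (d + f) + b * (c + e) ≡ (a * d + b * c) + (a * f + b * e)
  distribˡ-im = solve-∀ ℚ-acr
  distribʳ-re : ∀ a b c d e f →
    (c + e) * a + - ((d + f) * b) ≡ (c * a + - (d * b)) + (e * a + - (f * b))
  distribʳ-re = solve-∀ ℚ-acr
  distribʳ-im : ∀ a b c d e f →
    (c + e) * b + (d + f) * a ≡ (c * b + d * a) + (e * b + f * a)
  distribʳ-im = solve-∀ ℚ-acr
  comm-re : ∀ a b c d → a * c + - (b * d) ≡ c * a + - (d * b)
  comm-re = solve-∀ ℚ-acr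
  comm-im : ∀ a b c d → a * d + b * c ≡ c * b + d * a
  comm-im = solve-∀ ℚ-acr

ℂ-commutativeRing : CommutativeRing 0ℓ 0ℓ
ℂ-commutativeRing = record { isCommutativeRing = ℂ-isCommutativeRing }

ℂ-ring : Ring 0ℓ 0ℓ
ℂ-ring = CommutativeRing.ring ℂ-commutativeRing

module _ {r ℓr m ℓm : Level} {R : Ring r ℓr} (M : LeftModule R m ℓm) where
  open Ring R using (Carrier; _≈_; 0#)
  open LeftModule M using (Carrierᴹ; _≈ᴹ_; _*ₗ_; 0ᴹ; +ᴹ-commutativeMonoid)
  open Sum +ᴹ-commutativeMonoid using (sum)

  linearCombination : ∀ {d} → Vector Carrier d → Vector Carrierᴹ d → Carrierᴹ
  linearCombination c v = sum (λ i → c i *ₗ v i)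

  record IsBasis {d : ℕ} (v : Vector Carrierᴹ d) : Set (r ⊔ˡ ℓr ⊔ˡ m ⊔ˡ ℓm) where
    field
      linearlyIndependent : ∀ c → linearCombination c v ≈ᴹ 0ᴹ → ∀ i → c i ≈ 0#
      spanning            : ∀ x → ∃ λ c → x ≈ᴹ linearCombination c v

  HasDimension : ℕ → Set (r ⊔ˡ ℓr ⊔ˡ m ⊔ˡ ℓm)
  HasDimension d = Σ (Vector Carrierᴹ d) IsBasis

record UnitalAlgebra {r ℓr : Level} (R : CommutativeRing r ℓr) (a ℓ : Level)
       : Set (r ⊔ˡ ℓr ⊔ˡ lsuc (a ⊔ˡ ℓ)) where
  private module R = CommutativeRing R
  infixr 7 _•_
  field
    ring : Ring a ℓ
  open Ring ring public
  field
    _•_          : R.Carrier → Carrier → Carrier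
    isLeftModule : IsLeftModule R.ring _≈_ _+_ 0# -_ _•_
    •-*-assocˡ   : ∀ c x y → (c • x) * y ≈ c • (x * y)
    •-*-assocʳ   : ∀ c x y → x * (c • y) ≈ c • (x * y)

  leftModule : LeftModule R.ring a ℓ
  leftModule = record { isLeftModule = isLeftModule }

module _ {r ℓr a ℓ : Level} {R : CommutativeRing r ℓr} (A : UnitalAlgebra R a ℓ) where
  open UnitalAlgebra A
    renaming (refl to ≈-refl; sym to ≈-sym; trans to ≈-trans)
  private module M = LeftModule leftModule

  Central : Carrier → Set (a ⊔ˡ ℓ)
  Central z = ∀ x → z * x ≈ x * z

  private
    +-central : ∀ {y z} → Central y → Central z → Central (y + z)
    +-central {y} {z} yc zc x =
      ≈-trans (distribʳ x y z) (≈-trans (+-cong (yc x) (zc x)) (≈-sym (distribˡ x y z)))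

    0-central : Central 0#
    0-central x = ≈-trans (zeroˡ x) (≈-sym (zeroʳ x))

    -‿central : ∀ {z} → Central z → Central (- z)
    -‿central {z} zc x =
      ≈-trans (≈-sym (-‿distribˡ-* z x)) (≈-trans (-‿cong (zc x)) (-‿distribʳ-* x z))
      where open RingProperties ring using (-‿distribˡ-*; -‿distribʳ-*)

    •-central : ∀ c {z} → Central z → Central (c • z)
    •-central c {z} zc x =
      ≈-trans (•-*-assocˡ c z x) (≈-trans (M.*ₗ-cong R-refl (zc x)) (≈-sym (•-*-assocʳ c x z)))
      where open CommutativeRing R using () renaming (refl to R-refl)

  centre : LeftModule (CommutativeRing.ring R) (a ⊔ˡ ℓ) ℓ
  centre = record
    { Carrierᴹ = Σ Carrier Central
    ; _≈ᴹ_ = λ y z → proj₁ y ≈ proj₁ z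
    ; _+ᴹ_ = λ (y , yc) (z , zc) → y + z , +-central yc zc
    ; _*ₗ_ = λ c (z , zc) → c • z , •-central c zc
    ; 0ᴹ = 0# , 0-central
    ; -ᴹ_ = λ (z , zc) → - z , -‿central zc
    ; isLeftModule = record
      { isLeftSemimodule = record
        { +ᴹ-isCommutativeMonoid = record
          { isMonoid = record
            { isSemigroup = record
              { isMagma = record
                { isEquivalence = record { refl = ≈-refl; sym = ≈-sym; trans = ≈-trans }
                ; ∙-cong = +-cong
                }
              ; assoc = λ x y z → +-assoc (proj₁ x) (proj₁ y) (proj₁ z)
              }
            ; identity = (λ x → +-identityˡ (proj₁ x)) , (λ x → +-identityʳ (proj₁ x))
            }
          ; comm = λ x y → +-comm (proj₁ x) (proj₁ y)
          }
        ; isPreleftSemimodule = record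
          { *ₗ-cong = M.*ₗ-cong
          ; *ₗ-zeroˡ = λ x → M.*ₗ-zeroˡ (proj₁ x)
          ; *ₗ-distribʳ = λ x c d → M.*ₗ-distribʳ (proj₁ x) c d
          ; *ₗ-identityˡ = λ x → M.*ₗ-identityˡ (proj₁ x)
          ; *ₗ-assoc = λ c d x → M.*ₗ-assoc c d (proj₁ x)
          ; *ₗ-zeroʳ = M.*ₗ-zeroʳ
          ; *ₗ-distribˡ = λ c x y → M.*ₗ-distribˡ c (proj₁ x) (proj₁ y)
          }
        }
      ; -ᴹ‿cong = -‿cong
      ; -ᴹ‿inverse = (λ x → -‿inverseˡ (proj₁ x)) , (λ x → -‿inverseʳ (proj₁ x))
      }
    }

-- Decidability of adjacency expresses that a graph is a finite combinatorial
-- object; classically it holds automatically.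
record Graph (n : ℕ) : Set₁ where
  field
    Adj        : Rel (Fin n) 0ℓ
    adj-irrefl : Irreflexive _≡_ Adj
    adj-sym    : Symmetric Adj
    adj?       : Decidable Adj

open Graph public

complete : ∀ n → Graph n
complete n = record
  { Adj        = _≢_
  ; adj-irrefl = λ i≡j i≢j → i≢j i≡j
  ; adj-sym    = ≢-sym
  ; adj?       = λ i j → ¬? (i Fin.≟ j)
  }

edgeless : ∀ n → Graph n
edgeless n = record
  { Adj        = λ _ _ → ⊥
  ; adj-irrefl = λ _ ()
  ; adj-sym    = λ ()
  ; adj?       = λ _ _ → no λ ()
  }

infixr 6 _∪_

_∪_ : ∀ {m n} → Graph m → Graph n → Graph (m ℕ.+ n)
_∪_ {m} {n} G H = record
  { Adj        = λ i j → Pointwise (Adj G) (Adj H) (splitAt m i) (splitAt m j)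
  ; adj-irrefl = λ { {i} refl p → irrefl (splitAt m i) p }
  ; adj-sym    = ⊎-symmetric (adj-sym G) (adj-sym H)
  ; adj?       = λ i j → ⊎-decidable (adj? G) (adj? H) (splitAt m i) (splitAt m j)
  }
  where
  irrefl : ∀ x → ¬ Pointwise (Adj G) (Adj H) x x
  irrefl _ (inj₁ p) = adj-irrefl G refl p
  irrefl _ (inj₂ p) = adj-irrefl H refl p

copies : ∀ {n} k → Graph n → Graph (k ℕ.* n)
copies zero    G = edgeless 0
copies (suc k) G = G ∪ copies k G

G⟨_,_⟩ : ∀ k m → Graph (k ℕ.* 2 ℕ.+ m)
G⟨ k , m ⟩ = copies k (complete 2) ∪ edgeless m

-- The Clifford graph algebra, given by generators and relations: formal
-- algebra expressions in e₁,…,eₙ modulo the least congruence containing the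
-- laws of a unital associative ℂ-algebra and the defining relations.

infixl 6 _⊕_
infixl 7 _⊗_
infix  8 ⊖_
infixr 7 _∙_

data Expr (n : ℕ) : Set where
  e       : Fin n → Expr n
  𝟎 𝟏     : Expr n
  _⊕_ _⊗_ : Expr n → Expr n → Expr n
  ⊖_      : Expr n → Expr n
  _∙_     : ℂ → Expr n → Expr n

infix 4 _⊢_∼_

data _⊢_∼_ {n : ℕ} (G : Graph n) : Expr n → Expr n → Set where
  e-square   : ∀ i → G ⊢ e i ⊗ e i ∼ ⊖ 𝟏
  e-anticomm : ∀ {i j} → i ≢ j → Adj G i j → G ⊢ e i ⊗ e j ∼ ⊖ (e j ⊗ e i)
  e-comm     : ∀ {i j} → i ≢ j → ¬ Adj G i j → G ⊢ e i ⊗ e j ∼ e j ⊗ e i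

  ∼-refl  : ∀ {x} → G ⊢ x ∼ x
  ∼-sym   : ∀ {x y} → G ⊢ x ∼ y → G ⊢ y ∼ x
  ∼-trans : ∀ {x y z} → G ⊢ x ∼ y → G ⊢ y ∼ z → G ⊢ x ∼ z
  ⊕-cong  : ∀ {x y u v} → G ⊢ x ∼ y → G ⊢ u ∼ v → G ⊢ x ⊕ u ∼ y ⊕ v
  ⊗-cong  : ∀ {x y u v} → G ⊢ x ∼ y → G ⊢ u ∼ v → G ⊢ x ⊗ u ∼ y ⊗ v
  ⊖-cong  : ∀ {x y} → G ⊢ x ∼ y → G ⊢ ⊖ x ∼ ⊖ y
  ∙-cong  : ∀ {c d x y} → c ≈ℂ d → G ⊢ x ∼ y → G ⊢ c ∙ x ∼ d ∙ y

  ⊕-assoc     : ∀ x y z → G ⊢ (x ⊕ y) ⊕ z ∼ x ⊕ (y ⊕ z)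
  ⊕-comm      : ∀ x y → G ⊢ x ⊕ y ∼ y ⊕ x
  ⊕-identityˡ : ∀ x → G ⊢ 𝟎 ⊕ x ∼ x
  ⊖-inverseˡ  : ∀ x → G ⊢ ⊖ x ⊕ x ∼ 𝟎
  ⊗-assoc     : ∀ x y z → G ⊢ (x ⊗ y) ⊗ z ∼ x ⊗ (y ⊗ z)
  ⊗-identityˡ : ∀ x → G ⊢ 𝟏 ⊗ x ∼ x
  ⊗-identityʳ : ∀ x → G ⊢ x ⊗ 𝟏 ∼ x
  ⊗-distribˡ  : ∀ x y z → G ⊢ x ⊗ (y ⊕ z) ∼ (x ⊗ y) ⊕ (x ⊗ z)
  ⊗-distribʳ  : ∀ x y z → G ⊢ (y ⊕ z) ⊗ x ∼ (y ⊗ x) ⊕ (z ⊗ x)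

  ∙-identity  : ∀ x → G ⊢ 1ℂ ∙ x ∼ x
  ∙-assoc     : ∀ c d x → G ⊢ (c *ℂ d) ∙ x ∼ c ∙ d ∙ x
  ∙-distribˡ  : ∀ c x y → G ⊢ c ∙ (x ⊕ y) ∼ (c ∙ x) ⊕ (c ∙ y)
  ∙-distribʳ  : ∀ x c d → G ⊢ (c +ℂ d) ∙ x ∼ (c ∙ x) ⊕ (d ∙ x)
  ∙-⊗-assocˡ  : ∀ c x y → G ⊢ (c ∙ x) ⊗ y ∼ c ∙ (x ⊗ y)
  ∙-⊗-assocʳ  : ∀ c x y → G ⊢ x ⊗ (c ∙ y) ∼ c ∙ (x ⊗ y)

module _ {n : ℕ} (G : Graph n) where

  cliffordRing : Ring 0ℓ 0ℓ
  cliffordRing = record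
    { Carrier = Expr n
    ; _≈_ = G ⊢_∼_
    ; _+_ = _⊕_
    ; _*_ = _⊗_
    ; -_ = ⊖_
    ; 0# = 𝟎
    ; 1# = 𝟏
    ; isRing = record
      { +-isAbelianGroup = record
        { isGroup = record
          { isMonoid = record
            { isSemigroup = record
              { isMagma = record
                { isEquivalence = record { refl = ∼-refl; sym = ∼-sym; trans = ∼-trans }
                ; ∙-cong = ⊕-cong
                }
              ; assoc = ⊕-assoc
              }
            ; identity = ⊕-identityˡ , (λ x → ∼-trans (⊕-comm x 𝟎) (⊕-identityˡ x))
            }
          ; inverse = ⊖-inverseˡ , (λ x → ∼-trans (⊕-comm x (⊖ x)) (⊖-inverseˡ x))
          ; ⁻¹-cong = ⊖-cong
          }
        ; comm = ⊕-comm
        }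
      ; *-cong = ⊗-cong
      ; *-assoc = ⊗-assoc
      ; *-identity = ⊗-identityˡ , ⊗-identityʳ
      ; distrib = ⊗-distribˡ , ⊗-distribʳ
      }
    }

  private
    module C = CommutativeRing ℂ-commutativeRing
    open Ring cliffordRing using (+-isCommutativeMonoid; -‿inverse)
    open RingProperties cliffordRing using (x+x≈x⇒x≈0)

    ∙-zeroˡ : ∀ x → G ⊢ 0ℂ ∙ x ∼ 𝟎
    ∙-zeroˡ x = x+x≈x⇒x≈0 (0ℂ ∙ x)
      (∼-trans (∼-sym (∙-distribʳ x 0ℂ 0ℂ)) (∙-cong (C.+-identityˡ 0ℂ) ∼-refl))

    ∙-zeroʳ : ∀ c → G ⊢ c ∙ 𝟎 ∼ 𝟎
    ∙-zeroʳ c = x+x≈x⇒x≈0 (c ∙ 𝟎)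
      (∼-trans (∼-sym (∙-distribˡ c 𝟎 𝟎)) (∙-cong C.refl (⊕-identityˡ 𝟎)))

  cliffordAlgebra : UnitalAlgebra ℂ-commutativeRing 0ℓ 0ℓ
  cliffordAlgebra = record
    { ring = cliffordRing
    ; _•_ = _∙_
    ; isLeftModule = record
      { isLeftSemimodule = record
        { +ᴹ-isCommutativeMonoid = +-isCommutativeMonoid
        ; isPreleftSemimodule = record
          { *ₗ-cong = ∙-cong
          ; *ₗ-zeroˡ = ∙-zeroˡ
          ; *ₗ-distribʳ = ∙-distribʳ
          ; *ₗ-identityˡ = ∙-identity
          ; *ₗ-assoc = ∙-assoc
          ; *ₗ-zeroʳ = ∙-zeroʳ
          ; *ₗ-distribˡ = ∙-distribˡ
          }
        }
      ; -ᴹ‿cong = ⊖-cong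
      ; -ᴹ‿inverse = -‿inverse
      }
    ; •-*-assocˡ = ∙-⊗-assocˡ
    ; •-*-assocʳ = ∙-⊗-assocʳ
    }

  Z : LeftModule ℂ-ring 0ℓ 0ℓ
  Z = centre cliffordAlgebra

-- The vertex counts are independent indices so that graphs whose numbers of
-- vertices agree only propositionally can be compared.
SameCliffordClass : ∀ {m n} → Graph m → Graph n → Set
SameCliffordClass {m} {n} G H =
  m ≡ n × ∃ λ d → HasDimension (Z G) d × HasDimension (Z H) d

-- A_G has the monomials e^S (S ⊆ {1,…,n}) as a basis, and e^S eᵢ = ± eᵢ e^S
-- with sign B(S,{i}), where B is the adjacency matrix seen as an alternating
-- form on 𝔽₂ⁿ. So the centre is spanned by the e^S with S in the radical of B.
-- Splitting off hyperbolic planes, the radical has 2^m elements with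
-- n − m = 2k even; for G(k,m) the radical has exactly 2^m elements.
-- Independence of the monomials comes from the action of A_G on functions on
-- 𝔽₂ⁿ in which eᵢ flips the i-th coordinate up to sign.

module Submission where

open import Defs
open import Algebra.Bundles using (CommutativeMonoid; CommutativeRing; Ring)
open import Algebra.Module.Bundles using (LeftModule)
import Algebra.Module.Properties.LeftModule as LeftModuleProperties
import Algebra.Properties.AbelianGroup as AbelianGroupProperties
import Algebra.Properties.CommutativeMonoid.Sum as CommutativeMonoidSum
import Algebra.Properties.CommutativeSemigroup as CommutativeSemigroupProperties
import Algebra.Properties.Group as GroupProperties
import Algebra.Properties.Ring as RingProperties
import Algebra.Properties.Semiring.Sum as SemiringSum
open import Data.Bool.Base using (Bool; true; false; not; if_then_else_; _∧_; _xor_)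
import Data.Bool.Properties as Bool
open import Data.Bool.Solver using (module xor-∧-Solver)
open import Data.Fin.Base using (Fin; zero; suc; punchIn; _↑ˡ_; _↑ʳ_; splitAt; join)
import Data.Fin.Properties as Fin
open import Data.Nat.Base using (ℕ; zero; suc; _+_; _*_; _^_; _≤_)
import Data.Nat.Properties as ℕ
open import Data.Product using (∃; ∃₂; ∃!; _×_; _,_; proj₁; proj₂)
open import Data.Product.Function.NonDependent.Propositional using (_×-↔_)
open import Data.Rational.Base as ℚ using (1ℚ; ½)
import Data.Rational.Properties as ℚ
open import Data.Sum.Base using (inj₁; inj₂)
open import Data.Sum.Relation.Binary.Pointwise using (⊎-decidable)
open import Data.Vec.Base as Vec
  using (Vec; []; _∷_; _++_; lookup; zipWith; replicate; tail; insertAt; removeAt; uncons)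
open import Data.Vec.Functional using (Vector)
import Data.Vec.Properties as Vec
open import Function.Base using (_∘_)
open import Function.Bundles using (_↔_; mk↔ₛ′; module Inverse)
open import Function.Properties.Inverse using (↔-sym; ↔-trans)
open import Relation.Binary.Definitions using (tri<; tri≈; tri>)
open import Relation.Binary.PropositionalEquality
  using (_≡_; _≢_; _≗_; refl; sym; trans; cong; cong₂; subst; module ≡-Reasoning)
import Relation.Binary.Reasoning.Setoid as SetoidReasoning
open import Relation.Nullary.Decidable using (Dec; does; yes; no; dec-true; dec-false)
open import Relation.Nullary.Negation using (¬_; contradiction)

open xor-∧-Solver using (solve; _:=_; _:+_; _:*_; con)

-- Vectors over 𝔽₂ and alternating forms

-- Two obstacles shape the proof. Equality in A_G is only a generated congruence, so inequalities
-- can be shown only by mapping out, and equality in ℂ is not decidable, so no step may branch on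
-- whether a scalar vanishes. For the first, an expression acts on the delta function of the empty
-- set; the resulting function `coeff` respects the congruence, and `fromCoeffs` inverts it because
-- it intertwines the action with left multiplication. This yields independence and spanning without
-- rewriting to a normal form. For the second, every case split is made on subsets of vertices: a
-- coefficient outside the radical is shown to equal its own negative, and 2 is invertible.

Bits : ℕ → Set
Bits = Vec Bool

infixl 6 _⊻_
_⊻_ : ∀ {n} → Bits n → Bits n → Bits n
_⊻_ = zipWith _xor_

zeros : ∀ {n} → Bits n
zeros {n} = replicate n false

zeros⊻zeros : ∀ n → zeros {n} ⊻ zeros ≡ zeros
zeros⊻zeros n = Vec.zipWith-identityˡ (λ _ → refl) zeros

infixr 7 _⊙_
_⊙_ : ∀ {n} → Bool → Bits n → Bits n
false ⊙ x = zeros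
true  ⊙ x = x

unit : ∀ {n} → Fin n → Bits n
unit zero    = true ∷ zeros
unit (suc i) = false ∷ unit i

x≡x-xor-x⇒x≡false : ∀ {x} → x ≡ x xor x → x ≡ false
x≡x-xor-x⇒x≡false {x} eq = trans eq (Bool.xor-same x)

x-xor-y≡false⇒x≡y : ∀ x y → x xor y ≡ false → x ≡ y
x-xor-y≡false⇒x≡y false false _ = refl
x-xor-y≡false⇒x≡y true  true  _ = refl

record AlternatingForm (n : ℕ) : Set where
  field
    form      : Bits n → Bits n → Bool
    additiveˡ : ∀ x y z → form (x ⊻ y) z ≡ form x z xor form y z
    additiveʳ : ∀ x y z → form x (y ⊻ z) ≡ form x y xor form x z
    alternating : ∀ x → form x x ≡ false

  -- Polarisation: in the expansion of `form (x ⊻ y) (x ⊻ y)`, which is `false`, only the two mixed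
  -- terms survive.
  symmetric : ∀ x y → form x y ≡ form y x
  symmetric x y = x-xor-y≡false⇒x≡y _ _ (begin
    form x y xor form y x
      ≡⟨ cong₂ _xor_ (cong (_xor form x y) (sym (alternating x)))
           (sym (trans (cong (form y x xor_) (alternating y)) (Bool.xor-identityʳ _))) ⟩
    (form x x xor form x y) xor (form y x xor form y y)
      ≡⟨ cong₂ _xor_ (sym (additiveʳ x x y)) (sym (additiveʳ y x y)) ⟩
    form x (x ⊻ y) xor form y (x ⊻ y)
      ≡⟨ sym (additiveˡ x y (x ⊻ y)) ⟩
    form (x ⊻ y) (x ⊻ y)
      ≡⟨ alternating (x ⊻ y) ⟩
    false ∎)
    where open ≡-Reasoning

  form-zerosˡ : ∀ y → form zeros y ≡ false
  form-zerosˡ y = x≡x-xor-x⇒x≡false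
    (trans (cong (λ x → form x y) (sym (zeros⊻zeros n))) (additiveˡ zeros zeros y))

  form-⊙ˡ : ∀ b x y → form (b ⊙ x) y ≡ b ∧ form x y
  form-⊙ˡ false x y = form-zerosˡ y
  form-⊙ˡ true  x y = refl

  Radical : Bits n → Set
  Radical x = ∀ y → form x y ≡ false

open AlternatingForm using (form; additiveˡ; additiveʳ; alternating; symmetric; Radical)

-- What enters the dimension of the centre is the number `2 ^ m` of elements of the radical, so its
-- size is recorded by a bijection with `Bits m`.
record Parametrisation {n : ℕ} (P : Bits n → Set) (m : ℕ) : Set where
  field
    ρ          : Bits m → Bits n
    injective  : ∀ {s t} → ρ s ≡ ρ t → s ≡ t
    sound      : ∀ t → P (ρ t)
    surjective : ∀ x → P x → ∃ λ t → ρ t ≡ x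

pullback : ∀ {m n} (φ : Bits m → Bits n) → (∀ x y → φ (x ⊻ y) ≡ φ x ⊻ φ y) →
           AlternatingForm n → AlternatingForm m
pullback φ φ-⊻ F = record
  { form      = λ x y → form F (φ x) (φ y)
  ; additiveˡ = λ x y z → trans (cong (λ w → form F w (φ z)) (φ-⊻ x y)) (additiveˡ F _ _ _)
  ; additiveʳ = λ x y z → trans (cong (form F (φ x)) (φ-⊻ y z)) (additiveʳ F _ _ _)
  ; alternating = λ x → alternating F (φ x)
  }

-- Over 𝔽₂ additivity is already linearity, so the values on the standard basis decide.
additive-vanishes : ∀ {n} (f : Bits n → Bool) → (∀ x y → f (x ⊻ y) ≡ f x xor f y) →
                    (∀ i → f (unit i) ≡ false) → ∀ x → f x ≡ false
additive-vanishes f f-⊻ f-unit [] = x≡x-xor-x⇒x≡false (f-⊻ [] [])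
additive-vanishes {suc n} f f-⊻ f-unit (b ∷ x) = begin
  f (b ∷ x)
    ≡⟨ cong f (cong₂ _∷_ (sym (Bool.xor-identityʳ b)) (sym (Vec.zipWith-identityˡ (λ _ → refl) x))) ⟩
  f ((b ∷ zeros) ⊻ (false ∷ x))
    ≡⟨ f-⊻ _ _ ⟩
  f (b ∷ zeros) xor f (false ∷ x)
    ≡⟨ cong₂ _xor_ (head-vanishes b) (additive-vanishes (f ∘ (false ∷_)) (λ y z → f-⊻ _ _) (f-unit ∘ suc) x) ⟩
  false ∎
  where
  open ≡-Reasoning
  head-vanishes : ∀ b → f (b ∷ zeros) ≡ false
  head-vanishes true  = f-unit zero
  head-vanishes false =
    x≡x-xor-x⇒x≡false (trans (cong (λ z → f (false ∷ z)) (sym (zeros⊻zeros n)))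
      (f-⊻ (false ∷ zeros) (false ∷ zeros)))

module _ {n : ℕ} (F : AlternatingForm (suc n)) where

  restrict : AlternatingForm n
  restrict = pullback (false ∷_) (λ _ _ → refl) F

  -- The hypothesis puts `unit zero` in the radical, so `F` ignores the heads of both arguments. The
  -- radical is then 𝔽₂ times the radical of `restrict`.
  radical-isolated : (∀ i → form F (unit zero) (false ∷ unit i) ≡ false) → ∀ {m} →
    Parametrisation (Radical restrict) m → Parametrisation (Radical F) (suc m)
  radical-isolated isolated P = record
    { ρ = λ { (b ∷ t) → b ∷ P.ρ t }
    ; injective = λ { {b ∷ s} {c ∷ t} eq → cong₂ _∷_ (Vec.∷-injectiveˡ eq) (P.injective (Vec.∷-injectiveʳ eq)) }
    ; sound = λ { (b ∷ t) (c ∷ y) → trans (drop-heads b c (P.ρ t) y) (P.sound t y) }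
    ; surjective = λ { (b ∷ x) r →
        let t , eq = P.surjective x (λ y → trans (sym (drop-heads b false x y)) (r (false ∷ y)))
        in b ∷ t , cong (b ∷_) eq }
    }
    where
    open ≡-Reasoning
    module P = Parametrisation P

    first-radical : ∀ y → form F (unit zero) y ≡ false
    first-radical = additive-vanishes (form F (unit zero)) (additiveʳ F (unit zero))
      λ { zero → alternating F _ ; (suc i) → isolated i }

    split : ∀ b x → b ∷ x ≡ (b ⊙ unit zero) ⊻ (false ∷ x)
    split false x = cong (false ∷_) (sym (Vec.zipWith-identityˡ (λ _ → refl) x))
    split true  x = cong (true ∷_) (sym (Vec.zipWith-identityˡ (λ _ → refl) x))

    drop-head : ∀ b x y → form F (b ∷ x) y ≡ form F (false ∷ x) y
    drop-head b x y = begin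
      form F (b ∷ x) y ≡⟨ cong (λ z → form F z y) (split b x) ⟩
      form F ((b ⊙ unit zero) ⊻ (false ∷ x)) y ≡⟨ additiveˡ F _ _ y ⟩
      form F (b ⊙ unit zero) y xor form F (false ∷ x) y
        ≡⟨ cong (_xor form F (false ∷ x) y) (trans (AlternatingForm.form-⊙ˡ F b _ y)
             (trans (cong (b ∧_) (first-radical y)) (Bool.∧-zeroʳ b))) ⟩
      form F (false ∷ x) y ∎

    drop-heads : ∀ b c x y → form F (b ∷ x) (c ∷ y) ≡ form F (false ∷ x) (false ∷ y)
    drop-heads b c x y = begin
      form F (b ∷ x) (c ∷ y)         ≡⟨ drop-head b x _ ⟩
      form F (false ∷ x) (c ∷ y)     ≡⟨ symmetric F _ _ ⟩
      form F (c ∷ y) (false ∷ x)     ≡⟨ drop-head c y _ ⟩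
      form F (false ∷ y) (false ∷ x) ≡⟨ symmetric F _ _ ⟩
      form F (false ∷ x) (false ∷ y) ∎

-- Splitting off a hyperbolic plane

insertAt-⊻ : ∀ {n} (x y : Bits n) i a b →
             insertAt (x ⊻ y) i (a xor b) ≡ insertAt x i a ⊻ insertAt y i b
insertAt-⊻ x        y        zero    a b = refl
insertAt-⊻ (_ ∷ x) (_ ∷ y) (suc i) a b = cong (_ ∷_) (insertAt-⊻ x y i a b)

insertAt-zeros : ∀ {n} (i : Fin (suc n)) → insertAt zeros i false ≡ zeros
insertAt-zeros zero            = refl
insertAt-zeros {suc n} (suc i) = cong (false ∷_) (insertAt-zeros i)

insertAt-unit : ∀ {n} (i : Fin (suc n)) → insertAt zeros i true ≡ unit i
insertAt-unit zero            = refl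
insertAt-unit {suc n} (suc i) = cong (false ∷_) (insertAt-unit i)

-- If B(E,F) = 1, the radical lies in the orthogonal complement of the
-- hyperbolic plane ⟨E,F⟩, which φ parametrises by dropping two coordinates.
module _ {n : ℕ} (B : AlternatingForm (suc (suc n))) (j : Fin (suc n))
         (pivot : form B (unit zero) (false ∷ unit j) ≡ true) where

  private
    E F : Bits (suc (suc n))
    E = unit zero
    F = false ∷ unit j

    ι : Bits n → Bits (suc (suc n))
    ι x = false ∷ insertAt x j false

    ι-⊻ : ∀ x y → ι (x ⊻ y) ≡ ι x ⊻ ι y
    ι-⊻ x y = cong (false ∷_) (insertAt-⊻ x y j false false)

    -- Orthogonal projection along the plane: `φ x` is ι x + B(ι x,F)·E + B(ι x,E)·F. The
    -- coefficients are crossed because `E` and `F` pair to 1 with each other and to 0 with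
    -- themselves.
    φ : Bits n → Bits (suc (suc n))
    φ x = form B (ι x) F ∷ insertAt x j (form B (ι x) E)

    φ-⊻ : ∀ x y → φ (x ⊻ y) ≡ φ x ⊻ φ y
    φ-⊻ x y = cong₂ _∷_ (additive F)
      (trans (cong (insertAt _ j) (additive E)) (insertAt-⊻ x y j _ _))
      where
      additive : ∀ z → form B (ι (x ⊻ y)) z ≡ form B (ι x) z xor form B (ι y) z
      additive z = trans (cong (λ w → form B w z) (ι-⊻ x y)) (additiveˡ B _ _ z)

    φ-injective : ∀ {x y} → φ x ≡ φ y → x ≡ y
    φ-injective {x} {y} eq = trans (sym (Vec.removeAt-insertAt x j _))
      (trans (cong (λ w → removeAt (tail w) j) eq) (Vec.removeAt-insertAt y j _))

    decompose : ∀ a b x → a ∷ insertAt x j b ≡ (a ⊙ E) ⊻ ((b ⊙ F) ⊻ ι x)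
    decompose a b x = sym (begin
      (a ⊙ E) ⊻ ((b ⊙ F) ⊻ ι x)
        ≡⟨ cong₂ _⊻_ (⊙-E a) (cong (_⊻ ι x) (⊙-F b)) ⟩
      ((a xor false) ∷ (zeros ⊻ (insertAt zeros j b ⊻ insertAt x j false)))
        ≡⟨ cong₂ _∷_ (Bool.xor-identityʳ a) (trans (Vec.zipWith-identityˡ (λ _ → refl) _)
             (trans (sym (insertAt-⊻ zeros x j b false))
               (cong₂ (λ z c → insertAt z j c) (Vec.zipWith-identityˡ (λ _ → refl) x) (Bool.xor-identityʳ b)))) ⟩
      a ∷ insertAt x j b ∎)
      where
      open ≡-Reasoning
      ⊙-E : ∀ a → a ⊙ E ≡ a ∷ zeros
      ⊙-E false = refl
      ⊙-E true  = refl
      ⊙-F : ∀ b → b ⊙ F ≡ false ∷ insertAt zeros j b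
      ⊙-F false = cong (false ∷_) (sym (insertAt-zeros j))
      ⊙-F true  = cong (false ∷_) (sym (insertAt-unit j))

    form-decomposed : ∀ a b x z → form B (a ∷ insertAt x j b) z ≡
      (a ∧ form B E z) xor ((b ∧ form B F z) xor form B (ι x) z)
    form-decomposed a b x z = begin
      form B (a ∷ insertAt x j b) z
        ≡⟨ cong (λ w → form B w z) (decompose a b x) ⟩
      form B ((a ⊙ E) ⊻ ((b ⊙ F) ⊻ ι x)) z
        ≡⟨ trans (additiveˡ B _ _ z) (cong (form B (a ⊙ E) z xor_) (additiveˡ B _ _ z)) ⟩
      form B (a ⊙ E) z xor (form B (b ⊙ F) z xor form B (ι x) z)
        ≡⟨ cong₂ (λ u v → u xor (v xor form B (ι x) z)) (B.form-⊙ˡ a E z) (B.form-⊙ˡ b F z) ⟩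
      (a ∧ form B E z) xor ((b ∧ form B F z) xor form B (ι x) z) ∎
      where
      open ≡-Reasoning
      module B = AlternatingForm B

    form-E : ∀ a b x → form B (a ∷ insertAt x j b) E ≡ b xor form B (ι x) E
    form-E a b x = begin
      form B (a ∷ insertAt x j b) E
        ≡⟨ form-decomposed a b x E ⟩
      (a ∧ form B E E) xor ((b ∧ form B F E) xor form B (ι x) E)
        ≡⟨ cong₂ (λ u v → (a ∧ u) xor ((b ∧ v) xor form B (ι x) E)) (alternating B E) (trans (symmetric B F E) pivot) ⟩
      (a ∧ false) xor ((b ∧ true) xor form B (ι x) E)
        ≡⟨ cong₂ (λ u v → u xor (v xor form B (ι x) E)) (Bool.∧-zeroʳ a) (Bool.∧-identityʳ b) ⟩
      b xor form B (ι x) E ∎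
      where open ≡-Reasoning

    form-F : ∀ a b x → form B (a ∷ insertAt x j b) F ≡ a xor form B (ι x) F
    form-F a b x = begin
      form B (a ∷ insertAt x j b) F
        ≡⟨ form-decomposed a b x F ⟩
      (a ∧ form B E F) xor ((b ∧ form B F F) xor form B (ι x) F)
        ≡⟨ cong₂ (λ u v → (a ∧ u) xor ((b ∧ v) xor form B (ι x) F)) pivot (alternating B F) ⟩
      (a ∧ true) xor ((b ∧ false) xor form B (ι x) F)
        ≡⟨ cong₂ (λ u v → u xor (v xor form B (ι x) F)) (Bool.∧-identityʳ a) (Bool.∧-zeroʳ b) ⟩
      a xor form B (ι x) F ∎
      where open ≡-Reasoning

    φ⊥E : ∀ x → form B (φ x) E ≡ false
    φ⊥E x = trans (form-E _ _ x) (Bool.xor-same (form B (ι x) E))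

    φ⊥F : ∀ x → form B (φ x) F ≡ false
    φ⊥F x = trans (form-F _ _ x) (Bool.xor-same (form B (ι x) F))

    -- `φ y` is orthogonal to `E` and `F`, so the components `a` and `b` along them contribute
    -- nothing.
    form-φ : ∀ a b x y → form B (a ∷ insertAt x j b) (φ y) ≡ form B (ι x) (φ y)
    form-φ a b x y = trans (form-decomposed a b x (φ y))
      (cong₂ _xor_ (kill a E (φ⊥E y)) (cong (_xor _) (kill b F (φ⊥F y))))
      where
      kill : ∀ c z → form B (φ y) z ≡ false → c ∧ form B z (φ y) ≡ false
      kill c z eq = trans (cong (c ∧_) (trans (symmetric B z _) eq)) (Bool.∧-zeroʳ c)

    coordinates : ∀ (P : Bits (suc (suc n)) → Set) →
                  (∀ a b x → P (a ∷ insertAt x j b)) → ∀ z → P z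
    coordinates P p (a ∷ z) =
      subst (λ w → P (a ∷ w)) (Vec.insertAt-removeAt z j) (p a (lookup z j) (removeAt z j))

  orthogonal : AlternatingForm n
  orthogonal = pullback φ φ-⊻ B

  -- The form is nondegenerate on the plane and the whole space is the orthogonal sum of the plane
  -- and the image of `φ`; hence the plane adds nothing to the radical.
  radical-hyperbolic : ∀ {m} →
    Parametrisation (Radical orthogonal) m → Parametrisation (Radical B) m
  radical-hyperbolic P = record
    { ρ = φ ∘ P.ρ
    ; injective = P.injective ∘ φ-injective
    ; sound = λ t → coordinates _ λ a b y →
        -- By `form-φ`, used in both directions, the arbitrary vector may be traded for `φ y`, which
        -- has the same `ι` part.
        trans (symmetric B _ _) (trans (form-φ a b y (P.ρ t))
          (trans (sym (form-φ _ _ y (P.ρ t))) (trans (symmetric B _ _) (P.sound t y))))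
    ; surjective = coordinates _ λ a b x r →
        -- Orthogonality to `F` and to `E` forces the two dropped coordinates to be those of `φ x`.
        let a≡ = x-xor-y≡false⇒x≡y _ _ (trans (sym (form-F a b x)) (r F))
            b≡ = x-xor-y≡false⇒x≡y _ _ (trans (sym (form-E a b x)) (r E))
            φx≡ = cong₂ (λ u v → u ∷ insertAt x j v) (sym a≡) (sym b≡)
            t , eq = P.surjective x (λ y → trans (cong (λ w → form B w (φ y)) φx≡) (r (φ y)))
        in t , trans (cong φ eq) φx≡
    }
    where module P = Parametrisation P

-- The induction runs over alternating forms rather than graphs, since `orthogonal` is in general
-- not the form of an induced subgraph. Each hyperbolic plane adds one to `k`, each isolated
-- coordinate one to `m`.
radical-parametrisation : ∀ {n} (B : AlternatingForm n) →
  ∃₂ λ k m → 2 * k + m ≡ n × Parametrisation (Radical B) m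
radical-parametrisation {zero} B = 0 , 0 , refl , record
  { ρ = λ t → t ; injective = λ eq → eq
  ; sound = λ { [] [] → alternating B [] } ; surjective = λ x _ → x , refl }
radical-parametrisation {suc n} B
  with Fin.any? (λ i → form B (unit zero) (false ∷ unit i) Bool.≟ true)
radical-parametrisation {suc n} B | no isolated
  with k , m , eq , P ← radical-parametrisation (restrict B) =
  k , suc m , trans (ℕ.+-suc (2 * k) m) (cong suc eq) ,
  radical-isolated B (λ i → Bool.¬-not (λ adj → isolated (i , adj))) P
-- A partner `j` of the first coordinate forces the dimension to be at least two.
radical-parametrisation {suc (suc n)} B | yes (j , pivot)
  with k , m , eq , P ← radical-parametrisation (orthogonal B j pivot) =
  suc k , m , trans (cong (_+ m) (ℕ.*-suc 2 k)) (cong (λ l → suc (suc l)) eq) ,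
  radical-hyperbolic B j pivot P

-- The form of a graph

infixr 7 _·_
_·_ : ∀ {n} → Bits n → (Fin n → Bool) → Bool
[]      · f = false
(s ∷ S) · f = (s ∧ f zero) xor (S · (f ∘ suc))

·-congʳ : ∀ {n} (S : Bits n) {f g : Fin n → Bool} → f ≗ g → S · f ≡ S · g
·-congʳ []      f≗g = refl
·-congʳ (s ∷ S) f≗g = cong₂ (λ u v → (s ∧ u) xor v) (f≗g zero) (·-congʳ S (f≗g ∘ suc))

·-zeroʳ : ∀ {n} (S : Bits n) {f : Fin n → Bool} → (∀ i → f i ≡ false) → S · f ≡ false
·-zeroʳ []      f≗0 = refl
·-zeroʳ (s ∷ S) f≗0 =
  cong₂ _xor_ (trans (cong (s ∧_) (f≗0 zero)) (Bool.∧-zeroʳ s)) (·-zeroʳ S (f≗0 ∘ suc))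

·-zeroˡ : ∀ {n} (f : Fin n → Bool) → zeros · f ≡ false
·-zeroˡ {zero}  f = refl
·-zeroˡ {suc n} f = ·-zeroˡ (f ∘ suc)

·-distribʳ : ∀ {n} (S T : Bits n) f → (S ⊻ T) · f ≡ S · f xor T · f
·-distribʳ []      []      f = refl
·-distribʳ (s ∷ S) (t ∷ T) f = trans (cong (((s xor t) ∧ f zero) xor_) (·-distribʳ S T (f ∘ suc)))
  (solve 5 (λ s t a u v → (s :+ t) :* a :+ (u :+ v) := (s :* a :+ u) :+ (t :* a :+ v)) refl
    s t (f zero) (S · (f ∘ suc)) (T · (f ∘ suc)))

·-distribˡ : ∀ {n} (S : Bits n) f g → S · (λ i → f i xor g i) ≡ S · f xor S · g
·-distribˡ []      f g = refl
·-distribˡ (s ∷ S) f g = trans (cong ((s ∧ (f zero xor g zero)) xor_) (·-distribˡ S (f ∘ suc) (g ∘ suc)))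
  (solve 5 (λ s a b u v → s :* (a :+ b) :+ (u :+ v) := (s :* a :+ u) :+ (s :* b :+ v)) refl
    s (f zero) (g zero) (S · (f ∘ suc)) (S · (g ∘ suc)))

·-scale : ∀ {n} (S : Bits n) b f → S · (λ i → b ∧ f i) ≡ b ∧ S · f
·-scale []      b f = sym (Bool.∧-zeroʳ b)
·-scale (s ∷ S) b f = trans (cong ((s ∧ (b ∧ f zero)) xor_) (·-scale S b (f ∘ suc)))
  (solve 4 (λ s b a u → s :* (b :* a) :+ b :* u := b :* (s :* a :+ u)) refl s b (f zero) (S · (f ∘ suc)))

·-unit : ∀ {n} (i : Fin n) f → unit i · f ≡ f i
·-unit zero    f = trans (cong (f zero xor_) (·-zeroˡ (f ∘ suc))) (Bool.xor-identityʳ _)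
·-unit (suc i) f = ·-unit i (f ∘ suc)

·-++ : ∀ {m n} (S : Bits m) (T : Bits n) f → (S ++ T) · f ≡ S · (f ∘ (_↑ˡ n)) xor T · (f ∘ (m ↑ʳ_))
·-++ []      T f = refl
·-++ (s ∷ S) T f = trans (cong ((s ∧ f zero) xor_) (·-++ S T (f ∘ suc))) (sym (Bool.xor-assoc (s ∧ f zero) _ _))

BoolMatrix : ℕ → Set
BoolMatrix n = Fin n → Fin n → Bool

Alternating : ∀ {n} → BoolMatrix n → Set
Alternating a = (∀ i → a i i ≡ false) × (∀ i j → a i j ≡ a j i)

matrixForm : ∀ {n} → BoolMatrix n → Bits n → Bits n → Bool
matrixForm a S T = T · (λ i → S · (λ j → a j i))

-- Peeling off the first coordinate leaves a zero diagonal entry, the form of the minor, and two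
-- mixed terms, which agree by symmetry of `a` and cancel modulo 2.
matrixForm-alternating : ∀ {n} {a : BoolMatrix n} → Alternating a → ∀ S → matrixForm a S S ≡ false
matrixForm-alternating alt [] = refl
matrixForm-alternating {a = a} alt@(irrefl , symm) (s ∷ S) = begin
  (s ∧ ((s ∧ a zero zero) xor S · (λ j → a (suc j) zero)))
    xor S · (λ i → (s ∧ a zero (suc i)) xor S · (λ j → a (suc j) (suc i)))
    ≡⟨ cong₂ (λ u v → (s ∧ ((s ∧ u) xor S · (λ j → a (suc j) zero))) xor v) (irrefl zero)
         (trans (·-distribˡ S _ _) (cong₂ _xor_ (·-scale S s _)
           (matrixForm-alternating {a = λ i j → a (suc i) (suc j)} (irrefl ∘ suc , λ i j → symm (suc i) (suc j)) S))) ⟩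
  (s ∧ ((s ∧ false) xor S · (λ j → a (suc j) zero))) xor ((s ∧ S · (λ i → a zero (suc i))) xor false)
    ≡⟨ cong (λ u → (s ∧ ((s ∧ false) xor u)) xor ((s ∧ S · (λ i → a zero (suc i))) xor false))
         (·-congʳ S (λ j → symm (suc j) zero)) ⟩
  (s ∧ ((s ∧ false) xor S · (λ j → a zero (suc j)))) xor ((s ∧ S · (λ i → a zero (suc i))) xor false)
    ≡⟨ solve 2 (λ s u → (s :* ((s :* con false) :+ u)) :+ ((s :* u) :+ con false) := con false) refl
         s (S · (λ i → a zero (suc i))) ⟩
  false ∎
  where open ≡-Reasoning

alternatingForm : ∀ {n} {a : BoolMatrix n} → Alternating a → AlternatingForm n
alternatingForm {a = a} alt = record
  { form      = matrixForm a
  ; additiveˡ = λ S T U → trans (·-congʳ U (λ i → ·-distribʳ S T _)) (·-distribˡ U _ _)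
  ; additiveʳ = λ S T U → ·-distribʳ T U _
  ; alternating = matrixForm-alternating alt
  }

module _ {n : ℕ} (G : Graph n) where

  adjacency : BoolMatrix n
  adjacency i j = does (adj? G i j)

  adjacency-alternating : Alternating adjacency
  adjacency-alternating = (λ i → dec-false (adj? G i i) (adj-irrefl G refl)) , symm
    where
    symm : ∀ i j → adjacency i j ≡ adjacency j i
    symm i j with adj? G i j
    ... | yes ij = sym (dec-true (adj? G j i) (adj-sym G ij))
    ... | no ¬ij = sym (dec-false (adj? G j i) (¬ij ∘ adj-sym G))

  -- Every vertex has an even number of neighbours in `S`: the radical condition tested on unit
  -- vectors only. It is decided by a search over the vertices and says that e^S commutes with each
  -- generator.
  GraphRadical : Bits n → Set
  GraphRadical S = ∀ i → S · (λ j → adjacency j i) ≡ false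

  graphRadical-parametrisation : ∃₂ λ k m → 2 * k + m ≡ n × Parametrisation GraphRadical m
  graphRadical-parametrisation
    with k , m , eq , P ← radical-parametrisation (alternatingForm adjacency-alternating) =
    k , m , eq , record
      { ρ = P.ρ
      ; injective = P.injective
      ; sound = λ t i → trans (sym (·-unit i _)) (P.sound t (unit i))
      ; surjective = λ x r → P.surjective x (λ y → ·-zeroʳ y r)
      }
    where module P = Parametrisation P

-- Radicals of disjoint unions and of G(k,m)

module _ {m n : ℕ} (G : Graph m) (H : Graph n) where

  private
    -- With `u` and `v` free, the known values of `splitAt` on `↑ˡ` and `↑ʳ` can be put in, after
    -- which the decision computes; for vertices on different sides it computes to `false`.
    ∪-decides : ∀ {i j u v} → splitAt m i ≡ u → splitAt m j ≡ v →
      adjacency (G ∪ H) i j ≡ does (⊎-decidable (adj? G) (adj? H) u v)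
    ∪-decides refl refl = refl

    column-left : ∀ S T (i : Fin m) →
      (S ++ T) · (λ j → adjacency (G ∪ H) j (i ↑ˡ n)) ≡ S · (λ j → adjacency G j i)
    column-left S T i = trans (·-++ S T _) (trans
      (cong₂ _xor_ (·-congʳ S (λ j → ∪-decides (Fin.splitAt-↑ˡ m j n) (Fin.splitAt-↑ˡ m i n)))
                   (·-zeroʳ T (λ j → ∪-decides (Fin.splitAt-↑ʳ m n j) (Fin.splitAt-↑ˡ m i n))))
      (Bool.xor-identityʳ _))

    column-right : ∀ S T (i : Fin n) →
      (S ++ T) · (λ j → adjacency (G ∪ H) j (m ↑ʳ i)) ≡ T · (λ j → adjacency H j i)
    column-right S T i = trans (·-++ S T _)
      (cong₂ _xor_ (·-zeroʳ S (λ j → ∪-decides (Fin.splitAt-↑ˡ m j n) (Fin.splitAt-↑ʳ m n i)))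
                   (·-congʳ T (λ j → ∪-decides (Fin.splitAt-↑ʳ m n j) (Fin.splitAt-↑ʳ m n i))))

  graphRadical-∪⁺ : ∀ S T → GraphRadical G S → GraphRadical H T → GraphRadical (G ∪ H) (S ++ T)
  graphRadical-∪⁺ S T rS rT i = subst (λ k → (S ++ T) · (λ j → adjacency (G ∪ H) j k) ≡ false)
    (Fin.join-splitAt m n i) (both (splitAt m i))
    where
    both : ∀ x → (S ++ T) · (λ j → adjacency (G ∪ H) j (join m n x)) ≡ false
    both (inj₁ i) = trans (column-left S T i) (rS i)
    both (inj₂ i) = trans (column-right S T i) (rT i)

  graphRadical-∪⁻ : ∀ S T → GraphRadical (G ∪ H) (S ++ T) → GraphRadical G S × GraphRadical H T
  graphRadical-∪⁻ S T r = (λ i → trans (sym (column-left S T i)) (r (i ↑ˡ n)))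
                        , (λ i → trans (sym (column-right S T i)) (r (m ↑ʳ i)))

graphRadical-K₂ : ∀ S → GraphRadical (complete 2) S → S ≡ zeros
graphRadical-K₂ (false ∷ false ∷ []) r = refl
graphRadical-K₂ (true  ∷ false ∷ []) r = contradiction (r (suc zero)) λ ()
graphRadical-K₂ (true  ∷ true  ∷ []) r = contradiction (r (suc zero)) λ ()
graphRadical-K₂ (false ∷ true  ∷ []) r = contradiction (r zero) λ ()

graphRadical-zeros : ∀ {n} (G : Graph n) → GraphRadical G zeros
graphRadical-zeros G i = ·-zeroˡ (λ j → adjacency G j i)

++-coordinates : ∀ m {n} (P : Bits (m + n) → Set) → (∀ S T → P (S ++ T)) → ∀ x → P x
++-coordinates m P p x with S , T , refl ← Vec.splitAt m x = p S T

graphRadical-copies-K₂ : ∀ k S → GraphRadical (copies k (complete 2)) S → S ≡ zeros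
graphRadical-copies-K₂ zero    []  r = refl
graphRadical-copies-K₂ (suc k) = ++-coordinates 2 _ λ S T r →
  let rS , rT = graphRadical-∪⁻ (complete 2) (copies k (complete 2)) S T r
  in cong₂ _++_ (graphRadical-K₂ S rS) (graphRadical-copies-K₂ k T rT)

G⟨k,m⟩-parametrisation : ∀ k m → Parametrisation (GraphRadical G⟨ k , m ⟩) m
G⟨k,m⟩-parametrisation k m = record
  { ρ = zeros {k * 2} ++_
  ; injective = Vec.++-injectiveʳ (zeros {k * 2}) zeros
  ; sound = λ T → graphRadical-∪⁺ K (edgeless m) zeros T (graphRadical-zeros K) (λ i → ·-zeroʳ T (λ _ → refl))
  ; surjective = ++-coordinates (k * 2) _ λ S T r →
      let rS , _ = graphRadical-∪⁻ K (edgeless m) S T r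
      in T , cong (_++ T) (sym (graphRadical-copies-K₂ k S rS))
  }
  where K = copies k (complete 2)

-- Linear combinations and dimension

module _ {a ℓ} (M : CommutativeMonoid a ℓ) where
  open CommutativeMonoid M using (Carrier; _≈_; ε; identityʳ; setoid)
    renaming (_∙_ to _⊞_; ∙-congˡ to ⊞-congˡ)
  open CommutativeMonoidSum M using (sum; sum-remove; sum-cong-≋; sum-replicate-zero)

  sum-single : ∀ {n} (f : Vector Carrier n) i → (∀ j → j ≢ i → f j ≈ ε) → sum f ≈ f i
  sum-single {suc n} f i f≈ε = begin
    sum f                                  ≈⟨ sum-remove {i = i} f ⟩
    f i ⊞ sum (λ j → f (punchIn i j))      ≈⟨ ⊞-congˡ (sum-cong-≋ (λ j →
                                                f≈ε (punchIn i j) (Fin.punchInᵢ≢i i j))) ⟩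
    f i ⊞ sum {n} (λ _ → ε)                ≈⟨ ⊞-congˡ (sum-replicate-zero n) ⟩
    f i ⊞ ε                                ≈⟨ identityʳ (f i) ⟩
    f i                                    ∎
    where open SetoidReasoning setoid

module _ {a ℓ b ℓ′} (M : CommutativeMonoid a ℓ) (N : CommutativeMonoid b ℓ′) where
  private
    module M = CommutativeMonoid M
    module N = CommutativeMonoid N
  open CommutativeMonoidSum M using () renaming (sum to sumᴹ)
  open CommutativeMonoidSum N using () renaming (sum to sumᴺ)

  sum-homo : (f : M.Carrier → N.Carrier) → f M.ε N.≈ N.ε →
             (∀ x y → f (x M.∙ y) N.≈ f x N.∙ f y) →
             ∀ {n} (v : Vector M.Carrier n) → f (sumᴹ v) N.≈ sumᴺ (f ∘ v)
  sum-homo f f-ε f-∙ {zero}  v = f-ε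
  sum-homo f f-ε f-∙ {suc n} v =
    N.trans (f-∙ (v zero) _) (N.∙-congˡ (sum-homo f f-ε f-∙ (v ∘ suc)))

module LinearCombination {r ℓr m ℓm} {R : Ring r ℓr} (M : LeftModule R m ℓm) where
  private
    module R = Ring R
  open LeftModule M
  open CommutativeMonoidSum +ᴹ-commutativeMonoid using (sum; sum-cong-≋; ∑-distrib-+)

  lc : ∀ {d} → Vector R.Carrier d → Vector Carrierᴹ d → Carrierᴹ
  lc = linearCombination M

  lc-cong : ∀ {d} {c c′ : Vector R.Carrier d} {v v′} →
            (∀ i → c i R.≈ c′ i) → (∀ i → v i ≈ᴹ v′ i) → lc c v ≈ᴹ lc c′ v′
  lc-cong c≈ v≈ = sum-cong-≋ (λ i → *ₗ-cong (c≈ i) (v≈ i))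

  lc-+ : ∀ {d} (c c′ : Vector R.Carrier d) v →
         lc (λ i → c i R.+ c′ i) v ≈ᴹ lc c v +ᴹ lc c′ v
  lc-+ c c′ v = ≈ᴹ-trans (sum-cong-≋ (λ i → *ₗ-distribʳ (v i) (c i) (c′ i)))
    (∑-distrib-+ (λ i → c i *ₗ v i) (λ i → c′ i *ₗ v i))

  *ₗ-sum : ∀ {d} a (v : Vector Carrierᴹ d) → a *ₗ sum v ≈ᴹ sum (λ i → a *ₗ v i)
  *ₗ-sum a = sum-homo +ᴹ-commutativeMonoid +ᴹ-commutativeMonoid (a *ₗ_) (*ₗ-zeroʳ a) (*ₗ-distribˡ a)

  lc-* : ∀ {d} a (c : Vector R.Carrier d) v → lc (λ i → a R.* c i) v ≈ᴹ a *ₗ lc c v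
  lc-* a c v = ≈ᴹ-trans (sum-cong-≋ (λ i → *ₗ-assoc a (c i) (v i)))
    (≈ᴹ-sym (*ₗ-sum a (λ i → c i *ₗ v i)))

  lc-0 : ∀ {d} (v : Vector Carrierᴹ d) → lc (λ _ → R.0#) v ≈ᴹ 0ᴹ
  lc-0 {d} v = ≈ᴹ-trans (sum-cong-≋ (λ i → *ₗ-zeroˡ (v i)))
    (CommutativeMonoidSum.sum-replicate-zero +ᴹ-commutativeMonoid d)

  -ᴹ≈-1*ₗ : ∀ x → -ᴹ x ≈ᴹ (R.- R.1#) *ₗ x
  -ᴹ≈-1*ₗ x = ≈ᴹ-sym (inverseʳ-uniqueᴹ x _ (begin
    x +ᴹ (R.- R.1#) *ₗ x             ≈⟨ +ᴹ-congʳ (*ₗ-identityˡ x) ⟨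
    R.1# *ₗ x +ᴹ (R.- R.1#) *ₗ x     ≈⟨ *ₗ-distribʳ x R.1# (R.- R.1#) ⟨
    (R.1# R.+ R.- R.1#) *ₗ x         ≈⟨ *ₗ-congʳ (R.-‿inverseʳ R.1#) ⟩
    R.0# *ₗ x                        ≈⟨ *ₗ-zeroˡ x ⟩
    0ᴹ                               ∎))
    where
    open SetoidReasoning ≈ᴹ-setoid
    open LeftModuleProperties M using (inverseʳ-uniqueᴹ)

  lc-single : ∀ {d} (c : Vector R.Carrier d) v i →
              (∀ j → j ≢ i → c j R.≈ R.0#) → lc c v ≈ᴹ c i *ₗ v i
  lc-single c v i c≈0 = sum-single +ᴹ-commutativeMonoid _ i
    (λ j j≢i → ≈ᴹ-trans (*ₗ-congʳ (c≈0 j j≢i)) (*ₗ-zeroˡ (v j)))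

  IsBasis-unique : ∀ {d} {v : Vector Carrierᴹ d} → IsBasis M v →
    ∀ c c′ → lc c v ≈ᴹ lc c′ v → ∀ i → c i R.≈ c′ i
  IsBasis-unique {v = v} basis c c′ eq i = x∙y⁻¹≈ε⇒x≈y (c i) (c′ i)
    (IsBasis.linearlyIndependent basis (λ i → c i R.+ R.- c′ i) (begin
      lc (λ i → c i R.+ R.- c′ i) v
        ≈⟨ lc-cong (λ i → R.+-congˡ (R.sym (-1*x≈-x (c′ i)))) (λ _ → ≈ᴹ-refl) ⟩
      lc (λ i → c i R.+ (R.- R.1#) R.* c′ i) v
        ≈⟨ lc-+ c _ v ⟩
      lc c v +ᴹ lc (λ i → (R.- R.1#) R.* c′ i) v
        ≈⟨ +ᴹ-cong eq (≈ᴹ-trans (lc-* _ c′ v) (≈ᴹ-sym (-ᴹ≈-1*ₗ _))) ⟩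
      lc c′ v +ᴹ -ᴹ lc c′ v
        ≈⟨ -ᴹ‿inverseʳ _ ⟩
      0ᴹ ∎) i)
    where
    open SetoidReasoning ≈ᴹ-setoid
    open RingProperties R using (-1*x≈-x)
    open GroupProperties R.+-group using (x∙y⁻¹≈ε⇒x≈y)

-- If P and Q are the transition matrices between bases of sizes d and d′, then
-- d = tr(PQ) = tr(QP) = d′ in R.
module _ {r ℓr m ℓm} (R : CommutativeRing r ℓr) (M : LeftModule (CommutativeRing.ring R) m ℓm) where
  private
    module R = CommutativeRing R
  open LeftModule M
  open LinearCombination M
  open SemiringSum R.semiring using (sum; sum-cong-≋; ∑-comm)
  private
    module Mˢ = CommutativeMonoidSum +ᴹ-commutativeMonoid

  private
    -- Substituting the expansions of `w` into that of `v i` writes `v i` in the basis `v` with row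
    -- `i` of PQ as coefficients. By uniqueness this is row `i` of the identity matrix.
    product-diagonal : ∀ {d d′} {v : Vector Carrierᴹ d} {w : Vector Carrierᴹ d′} → IsBasis M v →
      (P : Fin d → Vector R.Carrier d′) → (∀ i → v i ≈ᴹ lc (P i) w) →
      (Q : Fin d′ → Vector R.Carrier d) → (∀ j → w j ≈ᴹ lc (Q j) v) →
      ∀ i → sum (λ j → P i j R.* Q j i) R.≈ R.1#
    product-diagonal {d} {d′} {v} {w} basis P v≈ Q w≈ i =
      R.trans (IsBasis-unique basis (λ k → sum (λ j → P i j R.* Q j k)) δᵢ same i) δᵢi≈1
      where
      open SetoidReasoning ≈ᴹ-setoid
      δᵢ : Fin d → R.Carrier
      δᵢ k = if does (k Fin.≟ i) then R.1# else R.0#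

      δᵢi≈1 : δᵢ i R.≈ R.1#
      δᵢi≈1 with i Fin.≟ i
      ... | yes _   = R.refl
      ... | no  i≢i = contradiction refl i≢i

      δᵢk≈0 : ∀ k → k ≢ i → δᵢ k R.≈ R.0#
      δᵢk≈0 k k≢i with k Fin.≟ i
      ... | yes k≡i = contradiction k≡i k≢i
      ... | no  _   = R.refl

      same : lc (λ k → sum (λ j → P i j R.* Q j k)) v ≈ᴹ lc δᵢ v
      same = begin
        Mˢ.sum (λ k → sum (λ j → P i j R.* Q j k) *ₗ v k)
          ≈⟨ Mˢ.sum-cong-≋ (λ k → sum-homo R.+-commutativeMonoid +ᴹ-commutativeMonoid (_*ₗ v k)
               (*ₗ-zeroˡ (v k)) (*ₗ-distribʳ (v k)) (λ j → P i j R.* Q j k)) ⟩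
        Mˢ.sum (λ k → Mˢ.sum (λ j → (P i j R.* Q j k) *ₗ v k))
          ≈⟨ Mˢ.∑-comm (λ k j → (P i j R.* Q j k) *ₗ v k) ⟩
        Mˢ.sum (λ j → lc (λ k → P i j R.* Q j k) v)
          ≈⟨ Mˢ.sum-cong-≋ (λ j → ≈ᴹ-trans (lc-* (P i j) (Q j) v) (*ₗ-congˡ (≈ᴹ-sym (w≈ j)))) ⟩
        lc (P i) w
          ≈⟨ v≈ i ⟨
        v i
          ≈⟨ *ₗ-identityˡ (v i) ⟨
        R.1# *ₗ v i
          ≈⟨ *ₗ-congʳ δᵢi≈1 ⟨
        δᵢ i *ₗ v i
          ≈⟨ lc-single δᵢ v i δᵢk≈0 ⟨
        lc δᵢ v ∎

  dimension-unique-in-scalars : ∀ {d d′} → HasDimension M d → HasDimension M d′ →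
    sum {d} (λ _ → R.1#) R.≈ sum {d′} (λ _ → R.1#)
  dimension-unique-in-scalars {d} {d′} (v , v-basis) (w , w-basis) = begin
    sum {d} (λ _ → R.1#)
      ≈⟨ sum-cong-≋ (λ i → R.sym (product-diagonal v-basis P v≈ Q w≈ i)) ⟩
    sum (λ i → sum (λ j → P i j R.* Q j i))
      ≈⟨ ∑-comm (λ i j → P i j R.* Q j i) ⟩
    sum (λ j → sum (λ i → P i j R.* Q j i))
      ≈⟨ sum-cong-≋ (λ j → sum-cong-≋ (λ i → R.*-comm (P i j) (Q j i))) ⟩
    sum (λ j → sum (λ i → Q j i R.* P i j))
      ≈⟨ sum-cong-≋ (λ j → product-diagonal w-basis Q w≈ P v≈ j) ⟩
    sum {d′} (λ _ → R.1#) ∎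
    where
    open SetoidReasoning R.setoid
    P = λ i → proj₁ (IsBasis.spanning w-basis (v i))
    v≈ = λ i → proj₂ (IsBasis.spanning w-basis (v i))
    Q = λ j → proj₁ (IsBasis.spanning v-basis (w j))
    w≈ = λ j → proj₂ (IsBasis.spanning v-basis (w j))

-- Characteristic zero

private
  module C = CommutativeRing ℂ-commutativeRing
  module Cˢ = SemiringSum C.semiring

-- The bound holds for each term of the representing sequence, which is what excludes convergence to
-- 0.
ℂ-sum-ones-positive : ∀ d n → 1ℚ ℚ.≤ seq (re (Cˢ.sum {suc d} (λ _ → 1ℂ))) n
ℂ-sum-ones-positive zero    n = ℚ.≤-refl
ℂ-sum-ones-positive (suc d) n =
  ℚ.≤-trans (ℚ.≤-reflexive (sym (ℚ.+-identityʳ 1ℚ)))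
    (ℚ.+-monoʳ-≤ 1ℚ (ℚ.≤-trans (ℚ.<⇒≤ (ℚ.positive⁻¹ 1ℚ)) (ℂ-sum-ones-positive d n)))

ℂ-sum-ones-nonzero : ∀ d → ¬ (Cˢ.sum {suc d} (λ _ → 1ℂ) ≈ℂ 0ℂ)
-- With tolerance 1, nullity would make the term at index `N` smaller than 1.
ℂ-sum-ones-nonzero d eq with null (re≈ eq) 1ℚ (ℚ.positive⁻¹ 1ℚ)
... | N , bound = ℚ.<-irrefl refl (ℚ.≤-<-trans 1≤s s<1)
  where
  s = seq (re (Cˢ.sum {suc d} (λ _ → 1ℂ))) N
  1≤s : 1ℚ ℚ.≤ s
  1≤s = ℂ-sum-ones-positive d N
  s<1 : s ℚ.< 1ℚ
  s<1 = subst (ℚ._< 1ℚ)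
    (trans (cong ℚ.∣_∣ (ℚ.+-identityʳ s)) (ℚ.0≤p⇒∣p∣≡p (ℚ.≤-trans (ℚ.<⇒≤ (ℚ.positive⁻¹ 1ℚ)) 1≤s)))
    (bound N ℕ.≤-refl)

ℂ-sum-ones-injective : ∀ d d′ → Cˢ.sum {d} (λ _ → 1ℂ) ≈ℂ Cˢ.sum {d′} (λ _ → 1ℂ) → d ≡ d′
ℂ-sum-ones-injective zero    zero     eq = refl
ℂ-sum-ones-injective zero    (suc d′) eq = contradiction (C.sym eq) (ℂ-sum-ones-nonzero d′)
ℂ-sum-ones-injective (suc d) zero     eq = contradiction eq (ℂ-sum-ones-nonzero d)
ℂ-sum-ones-injective (suc d) (suc d′) eq =
  cong suc (ℂ-sum-ones-injective d d′ (+-cancelˡ 1ℂ _ _ eq))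
  where open GroupProperties C.+-group using () renaming (∙-cancelˡ to +-cancelˡ)

dimension-unique : ∀ {m ℓm} (M : LeftModule ℂ-ring m ℓm) {d d′} →
                   HasDimension M d → HasDimension M d′ → d ≡ d′
dimension-unique M {d} {d′} p q =
  ℂ-sum-ones-injective d d′ (dimension-unique-in-scalars ℂ-commutativeRing M p q)

-- Signs

½ℂ : ℂ
½ℂ .re .seq _  = ½
½ℂ .re .cauchy = CauchyLemmas.cauchy-const ½
½ℂ .im = 0ℝ

½+½≈1 : ½ℂ +ℂ ½ℂ ≈ℂ 1ℂ
½+½≈1 = mk≈ℂ (≈ℝ-pointwise (λ _ → refl)) (≈ℝ-pointwise (λ _ → refl))

-- With an explicit inverse of 2, z = ½(z + z) = ½(z - z). This kills the coefficients of a central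
-- element outside the radical.
z≈-z⇒z≈0 : ∀ {z} → z ≈ℂ -ℂ z → z ≈ℂ 0ℂ
z≈-z⇒z≈0 {z} eq = begin
  z                       ≈⟨ C.*-identityˡ z ⟨
  1ℂ *ℂ z                 ≈⟨ C.*-congʳ {z} ½+½≈1 ⟨
  (½ℂ +ℂ ½ℂ) *ℂ z         ≈⟨ C.distribʳ z ½ℂ ½ℂ ⟩
  ½ℂ *ℂ z +ℂ ½ℂ *ℂ z      ≈⟨ C.distribˡ ½ℂ z z ⟨
  ½ℂ *ℂ (z +ℂ z)          ≈⟨ C.*-congˡ {½ℂ} (C.+-congˡ {z} eq) ⟩
  ½ℂ *ℂ (z +ℂ -ℂ z)       ≈⟨ C.*-congˡ {½ℂ} (C.-‿inverseʳ z) ⟩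
  ½ℂ *ℂ 0ℂ                ≈⟨ C.zeroʳ ½ℂ ⟩
  0ℂ                      ∎
  where open SetoidReasoning C.setoid

open RingProperties ℂ-ring using (-1*x≈-x; -‿involutive)

sgn : Bool → ℂ
sgn false = 1ℂ
sgn true  = -ℂ 1ℂ

sgn-xor : ∀ a b → sgn (a xor b) ≈ℂ sgn a *ℂ sgn b
sgn-xor false b     = C.sym (C.*-identityˡ _)
sgn-xor true  false = C.sym (C.*-identityʳ _)
sgn-xor true  true  = C.sym (C.trans (-1*x≈-x _) (-‿involutive _))

sgn-* : ∀ a b z → sgn a *ℂ (sgn b *ℂ z) ≈ℂ sgn (a xor b) *ℂ z
sgn-* a b z = C.trans (C.sym (C.*-assoc _ _ z)) (C.*-congʳ {z} (C.sym (sgn-xor a b)))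

sgn-cancel : ∀ b {y z} → sgn b *ℂ y ≈ℂ sgn b *ℂ z → y ≈ℂ z
sgn-cancel b {y} {z} eq = begin
  y                      ≈⟨ involutive y ⟨
  sgn b *ℂ (sgn b *ℂ y)  ≈⟨ C.*-congˡ {sgn b} eq ⟩
  sgn b *ℂ (sgn b *ℂ z)  ≈⟨ involutive z ⟩
  z                      ∎
  where
  open SetoidReasoning C.setoid
  involutive : ∀ w → sgn b *ℂ (sgn b *ℂ w) ≈ℂ w
  involutive w = C.trans (sgn-* b b w)
    (C.trans (C.reflexive (cong (λ c → sgn c *ℂ w) (Bool.xor-same b))) (C.*-identityˡ w))

-- The sign cocycle

flip : ∀ {n} → Fin n → Bits n → Bits n
flip zero    (s ∷ S) = not s ∷ S
flip (suc i) (s ∷ S) = s ∷ flip i S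

flip-involutive : ∀ {n} (i : Fin n) S → flip i (flip i S) ≡ S
flip-involutive zero    (s ∷ S) = cong (_∷ S) (Bool.not-involutive s)
flip-involutive (suc i) (s ∷ S) = cong (s ∷_) (flip-involutive i S)

flip-comm : ∀ {n} (i j : Fin n) S → flip i (flip j S) ≡ flip j (flip i S)
flip-comm zero    zero    (s ∷ S) = refl
flip-comm zero    (suc j) (s ∷ S) = refl
flip-comm (suc i) zero    (s ∷ S) = refl
flip-comm (suc i) (suc j) (s ∷ S) = cong (s ∷_) (flip-comm i j S)

minor : ∀ {n} → BoolMatrix (suc n) → BoolMatrix n
minor a i j = a (suc i) (suc j)

-- The sign exponent in eᵢ·e^S = ± e^{S ∆ {i}}, where e^S is the product of the
-- generators in S in increasing order.
β : ∀ {n} → BoolMatrix n → Fin n → Bits n → Bool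
β a zero    (s ∷ S) = s
β a (suc i) (s ∷ S) = (s ∧ a (suc i) zero) xor β (minor a) i S

-- The relation eᵢ² = -1 in terms of exponents: multiplying e^S by eᵢ twice collects both values of
-- `β`.
β-flip : ∀ {n} (a : BoolMatrix n) i S → β a i (flip i S) ≡ not (β a i S)
β-flip a zero    (s ∷ S) = refl
β-flip a (suc i) (s ∷ S) = trans (cong ((s ∧ a (suc i) zero) xor_) (β-flip (minor a) i S))
  (sym (Bool.not-distribʳ-xor (s ∧ a (suc i) zero) _))

-- The cocycle identity behind the commutation relations: the two sides compare the exponents of
-- eⱼeᵢ and eᵢeⱼ applied to e^S. It covers i = j because the diagonal is `false`.
β-swap : ∀ {n} {a : BoolMatrix n} → Alternating a → ∀ i j S →
  β a i S xor β a j (flip i S) ≡ a i j xor (β a j S xor β a i (flip j S))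
β-swap (irrefl , symm) zero zero (s ∷ S) rewrite irrefl zero = refl
β-swap {a = a} (irrefl , symm) zero (suc j) (s ∷ S) rewrite symm zero (suc j) =
  solve 3 (λ s a b → s :+ ((con true :+ s) :* a :+ b) := a :+ ((s :* a :+ b) :+ s)) refl
    s (a (suc j) zero) (β (minor a) j S)
β-swap {a = a} (irrefl , symm) (suc i) zero (s ∷ S) =
  solve 3 (λ s a b → (s :* a :+ b) :+ s := a :+ (s :+ ((con true :+ s) :* a :+ b))) refl
    s (a (suc i) zero) (β (minor a) i S)
β-swap {a = a} (irrefl , symm) (suc i) (suc j) (s ∷ S) = begin
  (u xor β a′ i S) xor (v xor β a′ j (flip i S))
    ≡⟨ solve 4 (λ u v x y → (u :+ x) :+ (v :+ y) := (u :+ v) :+ (x :+ y)) refl u v _ _ ⟩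
  (u xor v) xor (β a′ i S xor β a′ j (flip i S))
    ≡⟨ cong ((u xor v) xor_) (β-swap (irrefl ∘ suc , λ i j → symm (suc i) (suc j)) i j S) ⟩
  (u xor v) xor (a′ i j xor (β a′ j S xor β a′ i (flip j S)))
    ≡⟨ solve 5 (λ u v x y z → (u :+ v) :+ (x :+ (y :+ z)) := x :+ ((v :+ y) :+ (u :+ z))) refl u v (a′ i j) _ _ ⟩
  a′ i j xor ((v xor β a′ j S) xor (u xor β a′ i (flip j S))) ∎
  where
  open ≡-Reasoning
  a′ = minor a
  u = s ∧ a (suc i) zero
  v = s ∧ a (suc j) zero

-- Delta functions and a numbering of the subsets

_≟_ : ∀ {n} (S T : Bits n) → Dec (S ≡ T)
_≟_ = Vec.≡-dec Bool._≟_

δ : ∀ {n} → Bits n → Bits n → ℂ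
δ S T = if does (S ≟ T) then 1ℂ else 0ℂ

δ-refl : ∀ {n} (S : Bits n) → δ S S ≈ℂ 1ℂ
δ-refl S = C.reflexive (cong (if_then 1ℂ else 0ℂ) (dec-true (S ≟ S) refl))

δ-≢ : ∀ {n} {S T : Bits n} → S ≢ T → δ S T ≈ℂ 0ℂ
δ-≢ {S = S} {T} S≢T = C.reflexive (cong (if_then 1ℂ else 0ℂ) (dec-false (S ≟ T) S≢T))

enumeration : ∀ n → Fin (2 ^ n) ↔ Bits n
enumeration zero    = mk↔ₛ′ (λ _ → []) (λ _ → zero) (λ { [] → refl }) (λ { zero → refl })
enumeration (suc n) = ↔-trans Fin.*↔× (↔-trans (Fin.2↔Bool ×-↔ enumeration n)
  (mk↔ₛ′ (λ (b , S) → b ∷ S) uncons (λ { (_ ∷ _) → refl }) (λ _ → refl)))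

module Enumeration (n : ℕ) where
  open Inverse (enumeration n) public
    using () renaming (to to nth; from to index; strictlyInverseˡ to nth-index; strictlyInverseʳ to index-nth)

  nth-injective : ∀ {i j} → nth i ≡ nth j → i ≡ j
  nth-injective {i} {j} eq = trans (sym (index-nth i)) (trans (cong index eq) (index-nth j))

-- The action of A_G on functions Bits n → ℂ

module _ {n : ℕ} (G : Graph n) where

  private
    a = adjacency G
    alt = adjacency-alternating G
    module A where
      open Ring (cliffordRing G) public using (setoid; +-commutativeMonoid)
      open UnitalAlgebra (cliffordAlgebra G) public using (leftModule)
    module Aˢ = CommutativeMonoidSum A.+-commutativeMonoid
    module L = LinearCombination A.leftModule

  -- Left multiplication on coefficient functions. The coefficient of e^S in eᵢ·v comes from e^T
  -- with T = `flip i S`, with exponent `β a i T`, which is `not (β a i S)` by `β-flip`.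
  act : Expr n → (Bits n → ℂ) → Bits n → ℂ
  act (e i)   v S = sgn (not (β a i S)) *ℂ v (flip i S)
  act 𝟎       v S = 0ℂ
  act 𝟏       v S = v S
  act (x ⊕ y) v S = act x v S +ℂ act y v S
  act (x ⊗ y) v S = act x (act y v) S
  act (⊖ x)   v S = -ℂ act x v S
  act (c ∙ x) v S = c *ℂ act x v S

  act-cong : ∀ x {v w} → (∀ S → v S ≈ℂ w S) → ∀ S → act x v S ≈ℂ act x w S
  act-cong (e i)   v≈w S = C.*-congˡ {sgn (not (β a i S))} (v≈w (flip i S))
  act-cong 𝟎       v≈w S = C.refl
  act-cong 𝟏       v≈w S = v≈w S
  act-cong (x ⊕ y) v≈w S = C.+-cong (act-cong x v≈w S) (act-cong y v≈w S)
  act-cong (x ⊗ y) v≈w S = act-cong x (act-cong y v≈w) S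
  act-cong (⊖ x)   v≈w S = C.-‿cong (act-cong x v≈w S)
  act-cong (c ∙ x) v≈w S = C.*-congˡ {c} (act-cong x v≈w S)

  -- Together with `act-*`, this is what soundness of `⊗-distribˡ` and `∙-⊗-assocʳ` amounts to,
  -- products acting by composition.
  act-+ : ∀ x v w S → act x (λ T → v T +ℂ w T) S ≈ℂ act x v S +ℂ act x w S
  act-+ (e i)   v w S = C.distribˡ _ _ _
  act-+ 𝟎       v w S = C.sym (C.+-identityˡ _)
  act-+ 𝟏       v w S = C.refl
  act-+ (x ⊕ y) v w S = C.trans (C.+-cong (act-+ x v w S) (act-+ y v w S)) (interchange _ _ _ _)
    where open CommutativeSemigroupProperties (CommutativeMonoid.commutativeSemigroup C.+-commutativeMonoid)
            using (interchange)
  act-+ (x ⊗ y) v w S = C.trans (act-cong x (act-+ y v w) S) (act-+ x _ _ S)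
  act-+ (⊖ x)   v w S = C.trans (C.-‿cong (act-+ x v w S)) (C.sym (⁻¹-∙-comm _ _))
    where open AbelianGroupProperties C.+-abelianGroup using (⁻¹-∙-comm)
  act-+ (c ∙ x) v w S = C.trans (C.*-congˡ {c} (act-+ x v w S)) (C.distribˡ c _ _)

  *-leftComm : ∀ x y z → x *ℂ (y *ℂ z) ≈ℂ y *ℂ (x *ℂ z)
  *-leftComm = x∙yz≈y∙xz
    where open CommutativeSemigroupProperties (CommutativeMonoid.commutativeSemigroup C.*-commutativeMonoid)
            using (x∙yz≈y∙xz)

  act-* : ∀ x c v S → act x (λ T → c *ℂ v T) S ≈ℂ c *ℂ act x v S
  act-* (e i)   c v S = *-leftComm (sgn (not (β a i S))) c (v (flip i S))
  act-* 𝟎       c v S = C.sym (C.zeroʳ c)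
  act-* 𝟏       c v S = C.refl
  act-* (x ⊕ y) c v S = C.trans (C.+-cong (act-* x c v S) (act-* y c v S)) (C.sym (C.distribˡ c _ _))
  act-* (x ⊗ y) c v S = C.trans (act-cong x (act-* y c v) S) (act-* x c _ S)
  act-* (⊖ x)   c v S = C.trans (C.-‿cong (act-* x c v S)) (-‿distribʳ-* c _)
    where open RingProperties ℂ-ring using (-‿distribʳ-*)
  act-* (d ∙ x) c v S = C.trans (C.*-congˡ {d} (act-* x c v S)) (*-leftComm d c _)

  act-e-square : ∀ i v S → act (e i ⊗ e i) v S ≈ℂ -ℂ v S
  act-e-square i v S = begin
    sgn (not (β a i S)) *ℂ (sgn (not (β a i (flip i S))) *ℂ v (flip i (flip i S)))
      ≡⟨ cong₂ (λ b T → sgn (not (β a i S)) *ℂ (sgn (not b) *ℂ v T)) (β-flip a i S) (flip-involutive i S) ⟩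
    sgn (not (β a i S)) *ℂ (sgn (not (not (β a i S))) *ℂ v S)
      ≈⟨ sgn-* (not (β a i S)) _ (v S) ⟩
    sgn (not (β a i S) xor not (not (β a i S))) *ℂ v S
      ≡⟨ cong (λ b → sgn b *ℂ v S) (Bool.xor-inverseʳ (not (β a i S))) ⟩
    -ℂ 1ℂ *ℂ v S
      ≈⟨ -1*x≈-x (v S) ⟩
    -ℂ v S ∎
    where open SetoidReasoning C.setoid

  act-e-swap : ∀ i j v S → act (e i ⊗ e j) v S ≈ℂ sgn (a i j) *ℂ act (e j ⊗ e i) v S
  act-e-swap i j v S = begin
    sgn (not (β a i S)) *ℂ (sgn (not (β a j (flip i S))) *ℂ v (flip j (flip i S)))
      ≈⟨ sgn-* (not (β a i S)) _ _ ⟩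
    sgn (not (β a i S) xor not (β a j (flip i S))) *ℂ v (flip j (flip i S))
      ≡⟨ cong₂ (λ b T → sgn b *ℂ v T) signs (flip-comm j i S) ⟩
    sgn (a i j xor (not (β a j S) xor not (β a i (flip j S)))) *ℂ v (flip i (flip j S))
      ≈⟨ sgn-* (a i j) _ _ ⟨
    sgn (a i j) *ℂ (sgn (not (β a j S) xor not (β a i (flip j S))) *ℂ v (flip i (flip j S)))
      ≈⟨ C.*-congˡ {sgn (a i j)} (sgn-* (not (β a j S)) _ _) ⟨
    sgn (a i j) *ℂ (sgn (not (β a j S)) *ℂ (sgn (not (β a i (flip j S))) *ℂ v (flip i (flip j S)))) ∎
    where
    open SetoidReasoning C.setoid
    signs : not (β a i S) xor not (β a j (flip i S)) ≡ a i j xor (not (β a j S) xor not (β a i (flip j S)))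
    signs = trans (Bool.xor-annihilates-not (β a i S) _) (trans (β-swap alt i j S)
      (cong (a i j xor_) (sym (Bool.xor-annihilates-not (β a j S) _))))

  act-sound : ∀ {x y} → G ⊢ x ∼ y → ∀ v S → act x v S ≈ℂ act y v S
  act-sound (e-square i) v S = act-e-square i v S
  act-sound (e-anticomm {i} {j} i≢j adj) v S = C.trans (act-e-swap i j v S)
    (C.trans (C.reflexive (cong (λ b → sgn b *ℂ act (e j ⊗ e i) v S) (dec-true (adj? G i j) adj))) (-1*x≈-x _))
  act-sound (e-comm {i} {j} i≢j ¬adj) v S = C.trans (act-e-swap i j v S)
    (C.trans (C.reflexive (cong (λ b → sgn b *ℂ act (e j ⊗ e i) v S) (dec-false (adj? G i j) ¬adj))) (C.*-identityˡ _))
  act-sound ∼-refl v S = C.refl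
  act-sound (∼-sym p) v S = C.sym (act-sound p v S)
  act-sound (∼-trans p q) v S = C.trans (act-sound p v S) (act-sound q v S)
  act-sound (⊕-cong p q) v S = C.+-cong (act-sound p v S) (act-sound q v S)
  act-sound (⊗-cong {x} {y} {u} {w} p q) v S =
    C.trans (act-cong x (act-sound q v) S) (act-sound p (act w v) S)
  act-sound (⊖-cong p) v S = C.-‿cong (act-sound p v S)
  act-sound (∙-cong c≈d p) v S = C.*-cong c≈d (act-sound p v S)
  act-sound (⊕-assoc x y z) v S = C.+-assoc _ _ _
  act-sound (⊕-comm x y) v S = C.+-comm _ _
  act-sound (⊕-identityˡ x) v S = C.+-identityˡ _
  act-sound (⊖-inverseˡ x) v S = C.-‿inverseˡ _
  act-sound (⊗-assoc x y z) v S = C.refl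
  act-sound (⊗-identityˡ x) v S = C.refl
  act-sound (⊗-identityʳ x) v S = C.refl
  act-sound (⊗-distribˡ x y z) v S = act-+ x _ _ S
  act-sound (⊗-distribʳ x y z) v S = C.refl
  act-sound (∙-identity x) v S = C.*-identityˡ _
  act-sound (∙-assoc c d x) v S = C.*-assoc c d _
  act-sound (∙-distribˡ c x y) v S = C.distribˡ c _ _
  act-sound (∙-distribʳ x c d) v S = C.distribʳ _ c d
  act-sound (∙-⊗-assocˡ c x y) v S = C.refl
  act-sound (∙-⊗-assocʳ c x y) v S = act-* x c _ S

  -- Monomials

  -- The family `x` is arbitrary because the recursion passes from `x` to `x ∘ suc`.
  mono : ∀ {k} → (Fin k → Expr n) → Bits k → Expr n
  mono x []          = 𝟏
  mono x (false ∷ S) = mono (x ∘ suc) S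
  mono x (true  ∷ S) = x zero ⊗ mono (x ∘ suc) S

  ⊖≈-1∙ : ∀ x → G ⊢ ⊖ x ∼ (-ℂ 1ℂ) ∙ x
  ⊖≈-1∙ = L.-ᴹ≈-1*ₗ

  sgn-∙ : ∀ b c x → G ⊢ sgn b ∙ sgn c ∙ x ∼ sgn (b xor c) ∙ x
  sgn-∙ b c x = ∼-trans (∼-sym (∙-assoc _ _ x)) (∙-cong (C.sym (sgn-xor b c)) ∼-refl)

  swap-⊗ : ∀ {x y} b → G ⊢ x ⊗ y ∼ sgn b ∙ (y ⊗ x) → ∀ z → G ⊢ x ⊗ (y ⊗ z) ∼ sgn b ∙ (y ⊗ (x ⊗ z))
  swap-⊗ {x} {y} b xy z = begin
    x ⊗ (y ⊗ z)              ≈⟨ ⊗-assoc x y z ⟨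
    (x ⊗ y) ⊗ z              ≈⟨ ⊗-cong xy ∼-refl ⟩
    (sgn b ∙ (y ⊗ x)) ⊗ z    ≈⟨ ∙-⊗-assocˡ _ _ z ⟩
    sgn b ∙ ((y ⊗ x) ⊗ z)    ≈⟨ ∙-cong C.refl (⊗-assoc y x z) ⟩
    sgn b ∙ (y ⊗ (x ⊗ z))    ∎
    where open SetoidReasoning A.setoid

  -- The algebraic meaning of `β`: `x i` moves past the earlier factors of the monomial, one
  -- commutation sign for each, and meeting a copy of itself gives -1.
  generator-⊗-mono : ∀ {k} (x : Fin k → Expr n) (b : BoolMatrix k) →
    (∀ i → G ⊢ x i ⊗ x i ∼ ⊖ 𝟏) → (∀ i j → G ⊢ x i ⊗ x j ∼ sgn (b i j) ∙ (x j ⊗ x i)) →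
    ∀ i S → G ⊢ x i ⊗ mono x S ∼ sgn (β b i S) ∙ mono x (flip i S)
  generator-⊗-mono x b sq comm zero (false ∷ S) = ∼-sym (∙-identity _)
  generator-⊗-mono x b sq comm zero (true  ∷ S) = begin
    x zero ⊗ (x zero ⊗ M)      ≈⟨ ⊗-assoc _ _ M ⟨
    (x zero ⊗ x zero) ⊗ M      ≈⟨ ⊗-cong (∼-trans (sq zero) (⊖≈-1∙ 𝟏)) ∼-refl ⟩
    ((-ℂ 1ℂ) ∙ 𝟏) ⊗ M          ≈⟨ ∙-⊗-assocˡ _ 𝟏 M ⟩
    (-ℂ 1ℂ) ∙ (𝟏 ⊗ M)          ≈⟨ ∙-cong C.refl (⊗-identityˡ M) ⟩
    (-ℂ 1ℂ) ∙ M                ∎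
    where
    open SetoidReasoning A.setoid
    M = mono (x ∘ suc) S
  generator-⊗-mono x b sq comm (suc i) (false ∷ S) =
    generator-⊗-mono (x ∘ suc) (minor b) (sq ∘ suc) (λ i j → comm (suc i) (suc j)) i S
  generator-⊗-mono x b sq comm (suc i) (true  ∷ S) = begin
    x (suc i) ⊗ (x zero ⊗ mono (x ∘ suc) S)
      ≈⟨ swap-⊗ (b (suc i) zero) (comm (suc i) zero) _ ⟩
    sgn (b (suc i) zero) ∙ (x zero ⊗ (x (suc i) ⊗ mono (x ∘ suc) S))
      ≈⟨ ∙-cong C.refl (⊗-cong ∼-refl
           (generator-⊗-mono (x ∘ suc) (minor b) (sq ∘ suc) (λ i j → comm (suc i) (suc j)) i S)) ⟩
    sgn (b (suc i) zero) ∙ (x zero ⊗ (sgn (β (minor b) i S) ∙ mono (x ∘ suc) (flip i S)))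
      ≈⟨ ∙-cong C.refl (∙-⊗-assocʳ _ _ _) ⟩
    sgn (b (suc i) zero) ∙ sgn (β (minor b) i S) ∙ (x zero ⊗ mono (x ∘ suc) (flip i S))
      ≈⟨ sgn-∙ (b (suc i) zero) _ _ ⟩
    sgn (b (suc i) zero xor β (minor b) i S) ∙ (x zero ⊗ mono (x ∘ suc) (flip i S)) ∎
    where open SetoidReasoning A.setoid

  -- `y` is carried leftwards with one sign per factor present in `S`. For `y` a generator and `c`
  -- its column of the adjacency matrix, the exponent is the one tested by `GraphRadical`.
  mono-⊗-comm : ∀ {k} (x : Fin k → Expr n) (y : Expr n) (c : Fin k → Bool) →
    (∀ i → G ⊢ x i ⊗ y ∼ sgn (c i) ∙ (y ⊗ x i)) →
    ∀ S → G ⊢ mono x S ⊗ y ∼ sgn (S · c) ∙ (y ⊗ mono x S)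
  mono-⊗-comm x y c comm [] =
    ∼-trans (⊗-identityˡ y) (∼-sym (∼-trans (∙-identity _) (⊗-identityʳ y)))
  mono-⊗-comm x y c comm (false ∷ S) = mono-⊗-comm (x ∘ suc) y (c ∘ suc) (comm ∘ suc) S
  mono-⊗-comm x y c comm (true  ∷ S) = begin
    (x zero ⊗ M) ⊗ y
      ≈⟨ ⊗-assoc _ M y ⟩
    x zero ⊗ (M ⊗ y)
      ≈⟨ ⊗-cong ∼-refl (mono-⊗-comm (x ∘ suc) y (c ∘ suc) (comm ∘ suc) S) ⟩
    x zero ⊗ (sgn (S · (c ∘ suc)) ∙ (y ⊗ M))
      ≈⟨ ∙-⊗-assocʳ _ _ _ ⟩
    sgn (S · (c ∘ suc)) ∙ (x zero ⊗ (y ⊗ M))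
      ≈⟨ ∙-cong C.refl (swap-⊗ (c zero) (comm zero) M) ⟩
    sgn (S · (c ∘ suc)) ∙ sgn (c zero) ∙ (y ⊗ (x zero ⊗ M))
      ≈⟨ sgn-∙ (S · (c ∘ suc)) (c zero) _ ⟩
    sgn (S · (c ∘ suc) xor c zero) ∙ (y ⊗ (x zero ⊗ M))
      ≡⟨ cong (λ b → sgn b ∙ (y ⊗ (x zero ⊗ M))) (Bool.xor-comm (S · (c ∘ suc)) (c zero)) ⟩
    sgn (c zero xor S · (c ∘ suc)) ∙ (y ⊗ (x zero ⊗ M)) ∎
    where
    open SetoidReasoning A.setoid
    M = mono (x ∘ suc) S

  e-swap : ∀ i j → G ⊢ e i ⊗ e j ∼ sgn (a i j) ∙ (e j ⊗ e i)
  e-swap i j with i Fin.≟ j | adj? G i j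
  ... | yes refl | yes adj = contradiction adj (adj-irrefl G refl)
  ... | yes refl | no _    = ∼-sym (∙-identity _)
  ... | no i≢j   | yes adj = ∼-trans (e-anticomm i≢j adj) (⊖≈-1∙ _)
  ... | no i≢j   | no ¬adj = ∼-trans (e-comm i≢j ¬adj) (∼-sym (∙-identity _))

  -- Under the action `δ S` behaves as e^S does in the algebra; compare `generator-⊗-mono`.
  act-e-δ : ∀ i S T → act (e i) (δ S) T ≈ℂ sgn (β a i S) *ℂ δ (flip i S) T
  act-e-δ i S T with flip i S ≟ T
  ... | yes refl = C.trans
    (C.reflexive (cong₂ (λ b U → sgn b *ℂ δ S U)
      (trans (cong not (β-flip a i S)) (Bool.not-involutive _)) (flip-involutive i S)))
    (C.*-congˡ {sgn (β a i S)} (δ-refl S))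
  ... | no S≢T = C.trans
    (C.*-congˡ {sgn (not (β a i T))} (δ-≢ (λ eq → S≢T (trans (cong (flip i) eq) (flip-involutive i T)))))
    (C.trans (C.zeroʳ _) (C.sym (C.zeroʳ _)))

  -- The recursion on S needs suffixes of the generators, embedded by f and g.
  act-mono : ∀ {k} (f : Fin k → Fin n) (g : Bits k → Bits n) (b : BoolMatrix k) →
    (∀ i S → flip (f i) (g S) ≡ g (flip i S)) → (∀ i S → β a (f i) (g S) ≡ β b i S) →
    ∀ S T → act (mono (e ∘ f) S) (δ (g zeros)) T ≈ℂ δ (g S) T
  act-mono f g b g-flip g-β []          T = C.refl
  act-mono f g b g-flip g-β (false ∷ S) T =
    act-mono (f ∘ suc) (g ∘ (false ∷_)) (minor b) (λ i S → g-flip (suc i) _) (λ i S → g-β (suc i) _) S T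
  act-mono f g b g-flip g-β (true  ∷ S) T = begin
    act (e (f zero)) (act (mono (e ∘ f ∘ suc) S) (δ (g zeros))) T
      ≈⟨ act-cong (e (f zero)) (act-mono (f ∘ suc) (g ∘ (false ∷_)) (minor b)
           (λ i S → g-flip (suc i) _) (λ i S → g-β (suc i) _) S) T ⟩
    act (e (f zero)) (δ (g (false ∷ S))) T
      ≈⟨ act-e-δ (f zero) _ T ⟩
    sgn (β a (f zero) (g (false ∷ S))) *ℂ δ (flip (f zero) (g (false ∷ S))) T
      -- The generator entering last is smaller than all those already present, so its exponent `β`
      -- is `false` and the sign is 1.
      ≡⟨ cong₂ (λ c U → sgn c *ℂ δ U T) (g-β zero _) (g-flip zero _) ⟩
    1ℂ *ℂ δ (g (true ∷ S)) T
      ≈⟨ C.*-identityˡ _ ⟩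
    δ (g (true ∷ S)) T ∎
    where open SetoidReasoning C.setoid

  -- Coefficients with respect to the monomials

  monomial : Bits n → Expr n
  monomial = mono e

  -- `δ zeros` stands for e^∅ = 1, so acting on it recovers the coordinates of `x` itself.
  coeff : Expr n → Bits n → ℂ
  coeff x = act x (δ zeros)

  coeff-cong : ∀ {x y} → G ⊢ x ∼ y → ∀ S → coeff x S ≈ℂ coeff y S
  coeff-cong x∼y = act-sound x∼y (δ zeros)

  coeff-monomial : ∀ S T → coeff (monomial S) T ≈ℂ δ S T
  coeff-monomial = act-mono (λ i → i) (λ S → S) a (λ _ _ → refl) (λ _ _ → refl)

  coeff-lc : ∀ {d} (c : Vector ℂ d) (v : Vector (Expr n) d) S →
             coeff (L.lc c v) S ≈ℂ Cˢ.sum (λ i → c i *ℂ coeff (v i) S)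
  coeff-lc c v S = sum-homo A.+-commutativeMonoid C.+-commutativeMonoid (λ x → coeff x S)
    C.refl (λ _ _ → C.refl) (λ i → c i ∙ v i)

  module _ {d : ℕ} (ρ : Fin d → Bits n) (c : Vector ℂ d) where

    coeff-monomials : ∀ S → coeff (L.lc c (monomial ∘ ρ)) S ≈ℂ Cˢ.sum (λ i → c i *ℂ δ (ρ i) S)
    coeff-monomials S = C.trans (coeff-lc c (monomial ∘ ρ) S)
      (Cˢ.sum-cong-≋ (λ i → C.*-congˡ {c i} (coeff-monomial (ρ i) S)))

    coeff-∈ : (∀ {i j} → ρ i ≡ ρ j → i ≡ j) → ∀ i → coeff (L.lc c (monomial ∘ ρ)) (ρ i) ≈ℂ c i
    coeff-∈ ρ-injective i = begin
      coeff (L.lc c (monomial ∘ ρ)) (ρ i)     ≈⟨ coeff-monomials (ρ i) ⟩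
      Cˢ.sum (λ j → c j *ℂ δ (ρ j) (ρ i))     ≈⟨ sum-single C.+-commutativeMonoid _ i (λ j j≢i →
                                                   C.trans (C.*-congˡ {c j} (δ-≢ (j≢i ∘ ρ-injective))) (C.zeroʳ (c j))) ⟩
      c i *ℂ δ (ρ i) (ρ i)                    ≈⟨ C.*-congˡ {c i} (δ-refl (ρ i)) ⟩
      c i *ℂ 1ℂ                               ≈⟨ C.*-identityʳ (c i) ⟩
      c i                                     ∎
      where open SetoidReasoning C.setoid

    coeff-∉ : ∀ {S} → (∀ i → ρ i ≢ S) → coeff (L.lc c (monomial ∘ ρ)) S ≈ℂ 0ℂ
    coeff-∉ {S} ∉ρ = C.trans (coeff-monomials S)
      (C.trans (Cˢ.sum-cong-≋ (λ i → C.trans (C.*-congˡ {c i} (δ-≢ (∉ρ i))) (C.zeroʳ (c i))))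
               (Cˢ.sum-replicate-zero d))

  open Enumeration n using (nth; index; nth-index; index-nth; nth-injective)

  fromCoeffs : (Bits n → ℂ) → Expr n
  fromCoeffs v = L.lc (v ∘ nth) (monomial ∘ nth)

  fromCoeffs-cong : ∀ {v w} → (∀ S → v S ≈ℂ w S) → G ⊢ fromCoeffs v ∼ fromCoeffs w
  fromCoeffs-cong v≈w = L.lc-cong (v≈w ∘ nth) (λ _ → ∼-refl)

  coeff-fromCoeffs : ∀ v S → coeff (fromCoeffs v) S ≈ℂ v S
  coeff-fromCoeffs v S =
    subst (λ T → coeff (fromCoeffs v) T ≈ℂ v T) (nth-index S) (coeff-∈ nth (v ∘ nth) nth-injective (index S))

  ⊗-lc : ∀ {d} x (c : Vector ℂ d) v → G ⊢ x ⊗ L.lc c v ∼ L.lc c (λ i → x ⊗ v i)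
  ⊗-lc x c v = ∼-trans
    (sum-homo A.+-commutativeMonoid A.+-commutativeMonoid (x ⊗_) (zeroʳ x) (⊗-distribˡ x) (λ i → c i ∙ v i))
    (Aˢ.sum-cong-≋ (λ i → ∙-⊗-assocʳ (c i) x (v i)))
    where
    open Ring (cliffordRing G) using (zeroʳ)

  lc-⊗ : ∀ {d} (c : Vector ℂ d) v x → G ⊢ L.lc c v ⊗ x ∼ L.lc c (λ i → v i ⊗ x)
  lc-⊗ c v x = ∼-trans
    (sum-homo A.+-commutativeMonoid A.+-commutativeMonoid (_⊗ x) (zeroˡ x) (λ y z → ⊗-distribʳ x y z) (λ i → c i ∙ v i))
    (Aˢ.sum-cong-≋ (λ i → ∙-⊗-assocˡ (c i) (v i) x))
    where
    open Ring (cliffordRing G) using (zeroˡ)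

  -- The sum over all subsets is reindexed by the involution `flip i`; the term at `flip i S` is
  -- `e i` times the term of `fromCoeffs v` at `S`.
  fromCoeffs-act-e : ∀ i v → G ⊢ fromCoeffs (act (e i) v) ∼ e i ⊗ fromCoeffs v
  fromCoeffs-act-e i v = begin
    fromCoeffs (act (e i) v)
      ≈⟨ Aˢ.sum-permute (λ k → act (e i) v (nth k) ∙ monomial (nth k)) flips ⟩
    L.lc (λ k → act (e i) v (nth (index (flip i (nth k))))) (λ k → monomial (nth (index (flip i (nth k)))))
      ≈⟨ Aˢ.sum-cong-≋ (λ k → term (nth k)) ⟩
    L.lc (v ∘ nth) (λ k → e i ⊗ monomial (nth k))
      ≈⟨ ⊗-lc (e i) (v ∘ nth) (monomial ∘ nth) ⟨
    e i ⊗ fromCoeffs v ∎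
    where
    open SetoidReasoning A.setoid
    flips : Fin (2 ^ n) ↔ Fin (2 ^ n)
    flips = ↔-trans (enumeration n) (↔-trans
      (mk↔ₛ′ (flip i) (flip i) (flip-involutive i) (flip-involutive i)) (↔-sym (enumeration n)))

    term : ∀ S → G ⊢ act (e i) v (nth (index (flip i S))) ∙ monomial (nth (index (flip i S)))
                   ∼ v S ∙ (e i ⊗ monomial S)
    term S = begin
      act (e i) v (nth (index (flip i S))) ∙ monomial (nth (index (flip i S)))
        ≡⟨ cong (λ T → act (e i) v T ∙ monomial T) (nth-index (flip i S)) ⟩
      (sgn (not (β a i (flip i S))) *ℂ v (flip i (flip i S))) ∙ monomial (flip i S)
        ≡⟨ cong₂ (λ b T → (sgn b *ℂ v T) ∙ monomial (flip i S))
             (trans (cong not (β-flip a i S)) (Bool.not-involutive _)) (flip-involutive i S) ⟩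
      (sgn (β a i S) *ℂ v S) ∙ monomial (flip i S)
        ≈⟨ ∙-cong (C.*-comm _ _) ∼-refl ⟩
      (v S *ℂ sgn (β a i S)) ∙ monomial (flip i S)
        ≈⟨ ∙-assoc _ _ _ ⟩
      v S ∙ sgn (β a i S) ∙ monomial (flip i S)
        ≈⟨ ∙-cong C.refl (generator-⊗-mono e a e-square e-swap i S) ⟨
      v S ∙ (e i ⊗ monomial S) ∎

  -- Taken at `δ zeros`, where `fromCoeffs` gives 𝟏, this shows that every expression is the
  -- combination of monomials given by its own `coeff`.
  fromCoeffs-act : ∀ x v → G ⊢ fromCoeffs (act x v) ∼ x ⊗ fromCoeffs v
  fromCoeffs-act (e i) v = fromCoeffs-act-e i v
  fromCoeffs-act 𝟎 v = ∼-trans (L.lc-0 (monomial ∘ nth)) (∼-sym (zeroˡ _))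
    where open Ring (cliffordRing G) using (zeroˡ)
  fromCoeffs-act 𝟏 v = ∼-sym (⊗-identityˡ _)
  fromCoeffs-act (x ⊕ y) v = ∼-trans (L.lc-+ (act x v ∘ nth) (act y v ∘ nth) (monomial ∘ nth))
    (∼-trans (⊕-cong (fromCoeffs-act x v) (fromCoeffs-act y v)) (∼-sym (⊗-distribʳ _ x y)))
  fromCoeffs-act (x ⊗ y) v = ∼-trans (fromCoeffs-act x (act y v))
    (∼-trans (⊗-cong ∼-refl (fromCoeffs-act y v)) (∼-sym (⊗-assoc x y _)))
  fromCoeffs-act (c ∙ x) v = ∼-trans (L.lc-* c (act x v ∘ nth) (monomial ∘ nth))
    (∼-trans (∙-cong C.refl (fromCoeffs-act x v)) (∼-sym (∙-⊗-assocˡ c x _)))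
  fromCoeffs-act (⊖ x) v = begin
    fromCoeffs (λ S → -ℂ act x v S)              ≈⟨ fromCoeffs-cong (λ S → -1*x≈-x (act x v S)) ⟨
    fromCoeffs (λ S → -ℂ 1ℂ *ℂ act x v S)        ≈⟨ L.lc-* (-ℂ 1ℂ) (act x v ∘ nth) (monomial ∘ nth) ⟩
    (-ℂ 1ℂ) ∙ fromCoeffs (act x v)               ≈⟨ ∙-cong C.refl (fromCoeffs-act x v) ⟩
    (-ℂ 1ℂ) ∙ (x ⊗ fromCoeffs v)                 ≈⟨ ∙-⊗-assocˡ _ x _ ⟨
    ((-ℂ 1ℂ) ∙ x) ⊗ fromCoeffs v                 ≈⟨ ⊗-cong (⊖≈-1∙ x) ∼-refl ⟨
    ⊖ x ⊗ fromCoeffs v                           ∎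
    where open SetoidReasoning A.setoid

  mono-zeros : ∀ {k} (x : Fin k → Expr n) → mono x zeros ≡ 𝟏
  mono-zeros {zero}  x = refl
  mono-zeros {suc k} x = mono-zeros (x ∘ suc)

  fromCoeffs-δzeros : G ⊢ fromCoeffs (δ zeros) ∼ 𝟏
  fromCoeffs-δzeros = begin
    fromCoeffs (δ zeros)
      ≈⟨ L.lc-single (δ zeros ∘ nth) (monomial ∘ nth) (index zeros)
           (λ k k≢ → δ-≢ (λ eq → k≢ (trans (sym (index-nth k)) (cong index (sym eq))))) ⟩
    δ zeros (nth (index zeros)) ∙ monomial (nth (index zeros))
      ≡⟨ cong (λ S → δ {n} zeros S ∙ monomial S) (nth-index zeros) ⟩
    δ {n} zeros zeros ∙ monomial zeros
      ≈⟨ ∙-cong (δ-refl {n} zeros) ∼-refl ⟩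
    1ℂ ∙ monomial zeros
      ≈⟨ ∙-identity _ ⟩
    monomial zeros
      ≡⟨ mono-zeros e ⟩
    𝟏 ∎
    where open SetoidReasoning A.setoid

  fromCoeffs-coeff : ∀ x → G ⊢ fromCoeffs (coeff x) ∼ x
  fromCoeffs-coeff x = ∼-trans (fromCoeffs-act x (δ zeros))
    (∼-trans (⊗-cong ∼-refl fromCoeffs-δzeros) (⊗-identityʳ x))

  coeff-injective : ∀ {x y} → (∀ S → coeff x S ≈ℂ coeff y S) → G ⊢ x ∼ y
  coeff-injective {x} {y} eq =
    ∼-trans (∼-sym (fromCoeffs-coeff x)) (∼-trans (fromCoeffs-cong eq) (fromCoeffs-coeff y))

  -- The centre

  commutes-with-generators⇒central : ∀ {z} → (∀ i → G ⊢ z ⊗ e i ∼ e i ⊗ z) → Central (cliffordAlgebra G) z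
  commutes-with-generators⇒central {z} comm = go
    where
    open SetoidReasoning A.setoid
    open Ring (cliffordRing G) using (zeroˡ; zeroʳ)
    open RingProperties (cliffordRing G) using (-‿distribˡ-*; -‿distribʳ-*)
    go : ∀ x → G ⊢ z ⊗ x ∼ x ⊗ z
    go (e i)   = comm i
    go 𝟎       = ∼-trans (zeroʳ z) (∼-sym (zeroˡ z))
    go 𝟏       = ∼-trans (⊗-identityʳ z) (∼-sym (⊗-identityˡ z))
    go (x ⊕ y) = ∼-trans (⊗-distribˡ z x y) (∼-trans (⊕-cong (go x) (go y)) (∼-sym (⊗-distribʳ z x y)))
    go (x ⊗ y) = begin
      z ⊗ (x ⊗ y)  ≈⟨ ⊗-assoc z x y ⟨
      (z ⊗ x) ⊗ y  ≈⟨ ⊗-cong (go x) ∼-refl ⟩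
      (x ⊗ z) ⊗ y  ≈⟨ ⊗-assoc x z y ⟩
      x ⊗ (z ⊗ y)  ≈⟨ ⊗-cong ∼-refl (go y) ⟩
      x ⊗ (y ⊗ z)  ≈⟨ ⊗-assoc x y z ⟨
      (x ⊗ y) ⊗ z  ∎
    go (⊖ x)   = ∼-trans (∼-sym (-‿distribʳ-* z x)) (∼-trans (⊖-cong (go x)) (-‿distribˡ-* x z))
    go (c ∙ x) = ∼-trans (∙-⊗-assocʳ c z x) (∼-trans (∙-cong C.refl (go x)) (∼-sym (∙-⊗-assocˡ c x z)))

  monomial-⊗-e : ∀ S i → G ⊢ monomial S ⊗ e i ∼ sgn (S · (λ j → a j i)) ∙ (e i ⊗ monomial S)
  monomial-⊗-e S i = mono-⊗-comm e (e i) (λ j → a j i) (λ j → e-swap j i) S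

  radical⇒central : ∀ S → GraphRadical G S → Central (cliffordAlgebra G) (monomial S)
  radical⇒central S rad = commutes-with-generators⇒central λ i → ∼-trans (monomial-⊗-e S i)
    (∼-trans (A-reflexive (cong (λ b → sgn b ∙ (e i ⊗ monomial S)) (rad i))) (∙-identity _))
    where open Ring (cliffordRing G) using () renaming (reflexive to A-reflexive)

  private
    -- Conjugation by eᵢ in coordinates: e^S acquires the sign by which it commutes with eᵢ.
    twist : Fin n → Expr n → Bits n → ℂ
    twist i z S = sgn (S · (λ j → a j i)) *ℂ coeff z S

  ⊗-e-twist : ∀ z i → G ⊢ z ⊗ e i ∼ e i ⊗ fromCoeffs (twist i z)
  ⊗-e-twist z i = begin
    z ⊗ e i
      ≈⟨ ⊗-cong (fromCoeffs-coeff z) ∼-refl ⟨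
    fromCoeffs (coeff z) ⊗ e i
      ≈⟨ lc-⊗ (coeff z ∘ nth) (monomial ∘ nth) (e i) ⟩
    L.lc (coeff z ∘ nth) (λ k → monomial (nth k) ⊗ e i)
      ≈⟨ Aˢ.sum-cong-≋ (λ k → term (nth k)) ⟩
    L.lc (twist i z ∘ nth) (λ k → e i ⊗ monomial (nth k))
      ≈⟨ ⊗-lc (e i) (twist i z ∘ nth) (monomial ∘ nth) ⟨
    e i ⊗ fromCoeffs (twist i z) ∎
    where
    open SetoidReasoning A.setoid
    term : ∀ S → G ⊢ coeff z S ∙ (monomial S ⊗ e i) ∼ twist i z S ∙ (e i ⊗ monomial S)
    term S = ∼-trans (∙-cong C.refl (monomial-⊗-e S i))
      (∼-trans (∼-sym (∙-assoc _ _ _)) (∙-cong (C.*-comm _ _) ∼-refl))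

  -- Read at `flip i S`, the two products have the coefficients of `x` and `y` at `S`, up to one
  -- common sign.
  e-⊗-cancel : ∀ i {x y} → G ⊢ e i ⊗ x ∼ e i ⊗ y → ∀ S → coeff x S ≈ℂ coeff y S
  e-⊗-cancel i {x} {y} eq S = subst (λ T → coeff x T ≈ℂ coeff y T) (flip-involutive i S)
    (sgn-cancel (not (β a i (flip i S))) (coeff-cong eq (flip i S)))

  central-coeff : ∀ {z} → Central (cliffordAlgebra G) z →
    ∀ i S → coeff z S ≈ℂ sgn (S · (λ j → a j i)) *ℂ coeff z S
  central-coeff {z} central i S = C.trans
    (e-⊗-cancel i (∼-trans (∼-sym (central (e i))) (⊗-e-twist z i)) S)
    (coeff-fromCoeffs (twist i z) S)

  central⇒supported-on-radical : ∀ {z} → Central (cliffordAlgebra G) z →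
    ∀ S → ¬ GraphRadical G S → coeff z S ≈ℂ 0ℂ
  central⇒supported-on-radical {z} central S ¬rad
    -- A finite search turns failure of the radical condition into an explicit vertex with odd
    -- pairing; conjugation by its generator changes the sign of this coefficient.
    with i , ≢false ← Fin.¬∀⟶∃¬ n (λ i → S · (λ j → a j i) ≡ false) (λ i → _ Bool.≟ false) ¬rad =
    z≈-z⇒z≈0 (C.trans (central-coeff central i S)
      (C.trans (C.reflexive (cong (λ b → sgn b *ℂ coeff z S) (Bool.¬-not ≢false))) (-1*x≈-x _)))

  centre-lc : ∀ {d} (c : Vector ℂ d) (v : Vector (LeftModule.Carrierᴹ (Z G)) d) →
    G ⊢ proj₁ (linearCombination (Z G) c v) ∼ L.lc c (proj₁ ∘ v)
  centre-lc c v = sum-homo (LeftModule.+ᴹ-commutativeMonoid (Z G)) A.+-commutativeMonoid proj₁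
    ∼-refl (λ _ _ → ∼-refl) (λ i → LeftModule._*ₗ_ (Z G) (c i) (v i))

  centre-dimension : ∀ {m} → Parametrisation (GraphRadical G) m → HasDimension (Z G) (2 ^ m)
  centre-dimension {m} P = basis , record
    { linearlyIndependent = λ c eq i → C.trans (C.sym (coeff-∈ ρ c ρ-injective i))
        (coeff-cong (∼-trans (∼-sym (centre-lc c basis)) eq) (ρ i))
    ; spanning = λ (z , central) → coeff z ∘ ρ ,
        ∼-trans (coeff-injective (expansion central)) (∼-sym (centre-lc (coeff z ∘ ρ) basis))
    }
    where
    module P = Parametrisation P
    module E = Enumeration m
    ρ : Fin (2 ^ m) → Bits n
    ρ = P.ρ ∘ E.nth

    ρ-injective : ∀ {i j} → ρ i ≡ ρ j → i ≡ j
    ρ-injective eq = E.nth-injective (P.injective eq)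

    basis : Vector (LeftModule.Carrierᴹ (Z G)) (2 ^ m)
    basis i = monomial (ρ i) , radical⇒central (ρ i) (P.sound (E.nth i))

    expansion : ∀ {z} → Central (cliffordAlgebra G) z → ∀ S →
                coeff z S ≈ℂ coeff (L.lc (coeff z ∘ ρ) (monomial ∘ ρ)) S
    -- The support of a central element is settled by deciding the condition on `S`, not by testing
    -- the complex coefficient.
    expansion {z} central S with Fin.all? (λ i → S · (λ j → a j i) Bool.≟ false)
    ... | yes rad with t , refl ← P.surjective S rad =
      subst (λ u → coeff z (P.ρ u) ≈ℂ coeff (L.lc (coeff z ∘ ρ) (monomial ∘ ρ)) (P.ρ u))
        (E.nth-index t) (C.sym (coeff-∈ ρ (coeff z ∘ ρ) ρ-injective (E.index t)))
    ... | no ¬rad = C.trans (central⇒supported-on-radical central S ¬rad)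
      (C.sym (coeff-∉ ρ (coeff z ∘ ρ) (λ { i refl → ¬rad (P.sound (E.nth i)) })))

-- Existence and uniqueness of the pair

2^-injective : ∀ m n → 2 ^ m ≡ 2 ^ n → m ≡ n
2^-injective m n eq with ℕ.<-cmp m n
... | tri< m<n _ _ = contradiction eq (ℕ.<⇒≢ (ℕ.^-monoʳ-< 2 ℕ.≤-refl m<n))
... | tri≈ _ m≡n _ = m≡n
... | tri> _ _ n<m = contradiction (sym eq) (ℕ.<⇒≢ (ℕ.^-monoʳ-< 2 ℕ.≤-refl n<m))

mainTheorem3 : (n : ℕ) → 1 ≤ n → (G : Graph n) →
    ∃! _≡_ λ ((k , m) : ℕ × ℕ) → 2 * k + m ≡ n × SameCliffordClass G⟨ k , m ⟩ G
mainTheorem3 n _ G with k , m , 2k+m≡n , P ← graphRadical-parametrisation G =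
  (k , m) ,
  (2k+m≡n , trans (cong (_+ m) (ℕ.*-comm k 2)) 2k+m≡n ,
    2 ^ m , centre-dimension G⟨ k , m ⟩ (G⟨k,m⟩-parametrisation k m) , centre-dimension G P) ,
  unique
  where
  -- The common dimension `d` is `2 ^ m` when computed for `G` and `2 ^ m′` for G(k′,m′), so m = m′;
  -- the vertex count then determines k.
  unique : ∀ {km} → 2 * proj₁ km + proj₂ km ≡ n × SameCliffordClass G⟨ proj₁ km , proj₂ km ⟩ G → (k , m) ≡ km
  unique {k′ , m′} (2k′+m′≡n , _ , d , dim′ , dim) = cong₂ _,_ k≡k′ m≡m′
    where
    m≡m′ : m ≡ m′
    m≡m′ = 2^-injective m m′ (trans (dimension-unique (Z G) (centre-dimension G P) dim)
      (dimension-unique (Z G⟨ k′ , m′ ⟩) dim′ (centre-dimension G⟨ k′ , m′ ⟩ (G⟨k,m⟩-parametrisation k′ m′))))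
    k≡k′ : k ≡ k′
    k≡k′ = ℕ.*-cancelˡ-≡ k k′ 2 (ℕ.+-cancelʳ-≡ m (2 * k) (2 * k′)
      (trans 2k+m≡n (trans (sym 2k′+m′≡n) (cong (2 * k′ +_) (sym m≡m′)))))
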